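{- For every positive integer $n$, the function $\Phi'$ is a bijection between well-labelled positive paths of size $n$ and marked labelled binary trees with $n$ leaves.
   Context: A well-labelled path of size $n$ is a pair $(\mathbf{p},\sigma)$ where $\mathbf{p}=p_1\ldots p_{n-1}$ is a word on $\{ -1,0,+1\}$ and $\sigma=\sigma_1\ldots\sigma_n$ is a permutation of $[n]=\{1,\ldots,n\}$ such that $p_i=-1$ implies $\sigma_i<\sigma_{i+1}$ and $p_i=1$ implies $\sigma_i>\sigma_{i+1}$. It is Motzkin if $\sum_{i=1}^j p_i\ge 0$ for $j=1,\ldots,n-2$ and $\sum_{i=1}^{n-1}p_i=-1$; it is positive if $\sum_{i=1}^j p_i\ge0$ for all $j=1,\ldots,n-1$. For a set $I$ of $m$ integers, $\lambda_I$ is the order-preserving bijection from $[m]$ to $I$. A labelled binary tree of size $n$ is a rooted tree with $n$ leaves carrying distinct labels in $[n]$, each (unlabelled) internal vertex having exactly two unordered children; a marked labelled binary tree is one in which one vertex (internal or leaf) is marked. For a bijection $\lambda$ and a tree $\tau$, $\lambda(\tau)$ replaces each leaf label $i$ by $\lambda(i)$. The map $\Phi$ from well-labelled Motzkin paths of size $n\ge2$ to labelled binary trees with $n\ge 2$ leaves is defined recursively: (i) the unique Motzkin path of size 2 ($\mathbf{p}=-1$, $\sigma=12$) maps to the unique tree of size 2; (ii) if $n>2$ and $p_1=0$, set $\mathbf{p}'=p_2\ldots p_{n-1}$, $\sigma'_i=\lambda^{ -1}_{[n]\setminus\{\sigma_1\}}(\sigma_{i+1})$, and $\Phi(\mathbf{p},\sigma)$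 is a root with one subtree a leaf labelled $\sigma_1$ and the other subtree $\lambda_{[n]\setminus\{\sigma_1\}}(\Phi(\mathbf{p}',\sigma'))$; (iii) if $n>2$ and $p_1=1$, let $k$ be least with $\sum_{i=1}^k p_i=0$, set $I'=\{\sigma_1,\ldots,\sigma_k\}$, $I''=\{\sigma_{k+1},\ldots,\sigma_n\}$, $p'_i=-p_{k-i}$ ($i<k$), $p''_i=p_{k+i}$ ($i<n-k$), $\sigma'_i=\lambda^{ -1}_{I'}(\sigma_{k+1-i})$, $\sigma''_i=\lambda^{ -1}_{I''}(\sigma_{k+i})$, and $\Phi(\mathbf{p},\sigma)$ is a root with subtrees $\lambda_{I'}(\Phi(\mathbf{p}',\sigma'))$ and $\lambda_{I''}(\Phi(\mathbf{p}'',\sigma''))$. The map $\Phi'$ on well-labelled positive paths is defined recursively: (i) the path of size 1 maps to the marked tree consisting of a single marked leaf; (ii) if $n>1$ and $p_1=0$, with $\mathbf{p}',\sigma'$ as in (ii) above, $\Phi'(\mathbf{p},\sigma)$ is an unmarked root with one subtree an unmarked leaf labelled $\sigma_1$ and the other the marked subtree $\lambda_{[n]\setminus\{\sigma_1\}}(\Phi'(\mathbf{p}',\sigma'))$; (iii) if $n>1$ and $p_1=1$, let $k\le n$ be the greatest integer such that $\sum_{i=1}^{j-1}p_i\ge1$ for all $j=2,\ldots,k-1$ and $\sum_{i=1}^{k-1}p_i=1$, and define $I',I'',\mathbf{p}',\mathbf{p}'',\sigma',\sigma''$ by the same formulas as in (iii) above. If $k=n$, $\Phi'(\mathbf{p},\sigma)$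 is the tree $\Phi(\mathbf{p}',\sigma')$ with its root marked; if $k<n$, $\Phi'(\mathbf{p},\sigma)$ is an unmarked root with the unmarked subtree $\lambda_{I'}(\Phi(\mathbf{p}',\sigma'))$ and the marked subtree $\lambda_{I''}(\Phi'(\mathbf{p}'',\sigma''))$. -}

module Defs where

open import Data.Integer as ℤ using (ℤ; 0ℤ; 1ℤ; -1ℤ; +_)
import Data.Integer.Properties as ℤₚ
open import Data.List using (List; []; _∷_; _++_; map; foldr; filter; length; take; drop; reverse; applyUpTo)
open import Data.List.Properties
open import Data.List.Membership.Propositional using (_∈_)
open import Data.List.Relation.Binary.Permutation.Propositional using (_↭_; ↭-refl; ↭-reflexive; ↭-sym; ↭-trans; ↭⇒↭ₛ)
open import Data.List.Relation.Binary.Permutation.Propositional.Properties using (map⁺; ++⁺; filter-↭; ↭-length; ↭-reverse; ∈-resp-↭)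
open import Data.List.Relation.Unary.All as All using (All; []; _∷_)
open import Data.List.Relation.Unary.AllPairs as AllPairs using (AllPairs; []; _∷_)
open import Data.List.Relation.Unary.Any using (here; there)
open import Data.List.Relation.Unary.Unique.Propositional using (Unique)
import Data.List.Relation.Unary.Linked.Properties as Linkedₚ
import Data.List.Relation.Unary.Unique.Propositional.Properties as Uniqueₚ
import Data.List.Relation.Binary.Permutation.Setoid.Properties as ↭ₛ
open import Data.List.Sort.Base using (SortingAlgorithm)
import Data.List.Sort.MergeSort as MergeSort
open import Data.Nat
open import Data.Nat.Induction using (<-wellFounded)
open import Data.Nat.Properties
open import Data.Product using (Σ; ∃; _×_; _,_; proj₁; proj₂)
open import Data.Sum using (_⊎_; inj₁; inj₂)
open import Function using (_∘_)
open import Induction.WellFounded using (Acc; acc)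
open import Relation.Binary.PropositionalEquality hiding ([_])
open import Relation.Nullary using (¬_; Dec; yes; no; contradiction)
open import Relation.Nullary.Decidable using (_×-dec_; _→-dec_)
open import Relation.Unary using (Decidable)

data Step : Set where
  down flat up : Step

value : Step → ℤ
value down = -1ℤ
value flat = 0ℤ
value up   = 1ℤ

neg : Step → Step
neg down = up
neg flat = flat
neg up   = down

sumℤ : List Step → ℤ
sumℤ p = foldr ℤ._+_ 0ℤ (map value p)

-- psum p j = p₁ + ⋯ + pⱼ
psum : List Step → ℕ → ℤ
psum p j = sumℤ (take j p)

[1‥_] : ℕ → List ℕ
[1‥ n ] = applyUpTo suc n

Compatible : Step → ℕ → ℕ → Set
Compatible s x y = (s ≡ down → x < y) × (s ≡ up → x > y)

-- The indices force σ to have exactly one letter more than p.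
data WellLabelled : List Step → List ℕ → Set where
  [-] : ∀ {x} → WellLabelled [] (x ∷ [])
  _∷_ : ∀ {s p x y σ} → Compatible s x y →
        WellLabelled p (y ∷ σ) → WellLabelled (s ∷ p) (x ∷ y ∷ σ)

record WellLabelledPath (n : ℕ) : Set where
  constructor path
  field
    steps        : List Step
    labels       : List ℕ
    permutation  : labels ↭ [1‥ n ]
    wellLabelled : WellLabelled steps labels

open WellLabelledPath public

IsMotzkin : ℕ → List Step → Set
IsMotzkin n p = (∀ j → 1 ≤ j → j ≤ n ∸ 2 → 0ℤ ℤ.≤ psum p j) × psum p (n ∸ 1) ≡ -1ℤ

IsPositive : ℕ → List Step → Set
IsPositive n p = ∀ j → 1 ≤ j → j ≤ n ∸ 1 → 0ℤ ℤ.≤ psum p j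

MotzkinPath : ℕ → Set
MotzkinPath n = Σ (WellLabelledPath n) λ P → IsMotzkin n (steps P)

PositivePath : ℕ → Set
PositivePath n = Σ (WellLabelledPath n) λ P → IsPositive n (steps P)

-- A path is the pair (p , σ); the proofs carried along are disregarded.
_≈_ : ∀ {n} → PositivePath n → PositivePath n → Set
(P , _) ≈ (Q , _) = steps P ≡ steps Q × labels P ≡ labels Q

data Tree : Set where
  leaf : ℕ → Tree
  node : Tree → Tree → Tree

leaves : Tree → List ℕ
leaves (leaf x)   = x ∷ []
leaves (node l r) = leaves l ++ leaves r

data Vertex : Tree → Set where
  root  : ∀ {t} → Vertex t
  left  : ∀ {l r} → Vertex l → Vertex (node l r)
  right : ∀ {l r} → Vertex r → Vertex (node l r)

relabel : (ℕ → ℕ) → Tree → Tree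
relabel f (leaf x)   = leaf (f x)
relabel f (node l r) = node (relabel f l) (relabel f r)

relabelVertex : ∀ f {t} → Vertex t → Vertex (relabel f t)
relabelVertex f root      = root
relabelVertex f (left v)  = left (relabelVertex f v)
relabelVertex f (right v) = right (relabelVertex f v)

-- n leaves with distinct labels in [n]: the leaf labels are exactly 1 , … , n,
-- each occurring once.
record LabelledTree (n : ℕ) : Set where
  constructor labelled
  field
    tree       : Tree
    isLabelled : leaves tree ↭ [1‥ n ]

open LabelledTree public

record MarkedTree (n : ℕ) : Set where
  constructor marked
  field
    underlying : LabelledTree n
    mark       : Vertex (tree underlying)

open MarkedTree public

-- Children are unordered: plane representatives are compared up to
-- exchanging the two children of any internal vertices.
data _≅_ : Tree → Tree → Set where
  leaf : ∀ {x} → leaf x ≅ leaf x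
  node : ∀ {l r l′ r′} → l ≅ l′ → r ≅ r′ → node l r ≅ node l′ r′
  swap : ∀ {l r l′ r′} → l ≅ r′ → r ≅ l′ → node l r ≅ node l′ r′

transport : ∀ {s t} → s ≅ t → Vertex s → Vertex t
transport _          root      = root
transport (node f g) (left v)  = left (transport f v)
transport (node f g) (right v) = right (transport g v)
transport (swap f g) (left v)  = right (transport f v)
transport (swap f g) (right v) = left (transport g v)

_≅•_ : ∀ {n} → MarkedTree n → MarkedTree n → Set
T ≅• U = Σ (tree (underlying T) ≅ tree (underlying U)) λ f → transport f (mark T) ≡ mark U

-- In Λ and Λ⁻¹ below, a finite set I of integers is given by a
-- list of its elements without repetition, in any order.

open SortingAlgorithm (MergeSort.mergeSort ≤-decTotalOrder) using (sort; sort-↭; sort-↗)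

-- 0-based, with junk value 0 out of range
at : List ℕ → ℕ → ℕ
at []       _       = 0
at (x ∷ xs) zero    = x
at (x ∷ xs) (suc i) = at xs i

-- The order-preserving bijection λ_I : [m] → I sends i to the i-th smallest
-- element of I.
Λ : List ℕ → ℕ → ℕ
Λ I i = at (sort I) (i ∸ 1)

-- λ_I⁻¹ : I → [m] sends x to its rank in I.
Λ⁻¹ : List ℕ → ℕ → ℕ
Λ⁻¹ I x = length (filter (_≤? x) I)

map-at : ∀ xs → applyUpTo (at xs) (length xs) ≡ xs
map-at []       = refl
map-at (x ∷ xs) = cong (x ∷_) (map-at xs)

Λ-↭ : ∀ I → map (Λ I) [1‥ length I ] ↭ I
Λ-↭ I = ↭-trans (↭-reflexive eq) (sort-↭ I)
  where
  eq : map (Λ I) [1‥ length I ] ≡ sort I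
  eq = trans (map-applyUpTo suc (Λ I) (length I))
       (trans (cong (applyUpTo (at (sort I))) (sym (↭-length (sort-↭ I)))) (map-at (sort I)))

Λ⁻¹-cong : ∀ {I J} → I ↭ J → ∀ x → Λ⁻¹ I x ≡ Λ⁻¹ J x
Λ⁻¹-cong p x = ↭-length (filter-↭ (_≤? x) p)

Unique-↭ : ∀ {xs ys : List ℕ} → xs ↭ ys → Unique xs → Unique ys
Unique-↭ p = ↭ₛ.Unique-resp-↭ (setoid ℕ) (↭⇒↭ₛ p)

sort-< : ∀ {I} → Unique I → AllPairs _<_ (sort I)
sort-< {I} u = AllPairs.zipWith (λ (a , b) → ≤∧≢⇒< a b)
  (Linkedₚ.Linked⇒AllPairs ≤-trans (sort-↗ I) , Unique-↭ (↭-sym (sort-↭ I)) u)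

rank-head : ∀ {x xs} → All (x <_) xs → Λ⁻¹ (x ∷ xs) x ≡ 1
rank-head {x} {xs} ps = trans (cong length (filter-accept (_≤? x) ≤-refl))
  (cong (suc ∘ length) (filter-none (_≤? x) (All.map <⇒≱ ps)))

rank-yes : ∀ {z y I} → z ≤ y → Λ⁻¹ (z ∷ I) y ≡ suc (Λ⁻¹ I y)
rank-yes {y = y} z≤y = cong length (filter-accept (_≤? y) z≤y)

rank-no : ∀ {z y I} → ¬ z ≤ y → Λ⁻¹ (z ∷ I) y ≡ Λ⁻¹ I y
rank-no {y = y} z≰y = cong length (filter-reject (_≤? y) z≰y)

rank-tail : ∀ {x y xs} → x < y → Λ⁻¹ (x ∷ xs) y ≡ suc (Λ⁻¹ xs y)
rank-tail x<y = rank-yes (<⇒≤ x<y)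

rank-sorted : ∀ {xs} → AllPairs _<_ xs → map (Λ⁻¹ xs) xs ≡ [1‥ length xs ]
rank-sorted []                  = refl
rank-sorted {x ∷ xs} (ps ∷ pss) = cong₂ _∷_ (rank-head ps)
  (trans (map-cong-local (All.map rank-tail ps))
  (trans (map-∘ xs)
  (trans (cong (map suc) (rank-sorted pss)) (map-applyUpTo suc suc (length xs)))))

at-rank : ∀ {xs} → AllPairs _<_ xs → ∀ {x} → x ∈ xs → at xs (Λ⁻¹ xs x ∸ 1) ≡ x
at-rank {x ∷ xs} (ps ∷ pss) (here refl) rewrite rank-head ps = refl
at-rank {x ∷ xs} (ps ∷ pss) {y} (there y∈) = trans
  (cong (λ k → at (x ∷ xs) (k ∸ 1)) (rank-tail (All.lookup ps y∈))) (lemma y∈ (at-rank pss y∈))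
  where
  pos : ∀ {ys} → y ∈ ys → ∃ λ k → Λ⁻¹ ys y ≡ suc k
  pos {z ∷ ys} (here refl) = _ , rank-yes {z} {z} {ys} ≤-refl
  pos {z ∷ ys} (there q) with z ≤? y
  ... | yes z≤y = _ , rank-yes {I = ys} z≤y
  ... | no  z≰y = _ , trans (rank-no {I = ys} z≰y) (proj₂ (pos q))
  lemma : y ∈ xs → at xs (Λ⁻¹ xs y ∸ 1) ≡ y → at (x ∷ xs) (Λ⁻¹ xs y) ≡ y
  lemma q e with Λ⁻¹ xs y | pos q
  ... | .(suc k) | k , refl = e

Λ⁻¹-↭ : ∀ {I} → Unique I → map (Λ⁻¹ I) I ↭ [1‥ length I ]
Λ⁻¹-↭ {I} u = ↭-trans (map⁺ (Λ⁻¹ I) (↭-sym (sort-↭ I))) (↭-reflexive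
  (trans (map-cong (Λ⁻¹-cong (↭-sym (sort-↭ I))) (sort I))
  (trans (rank-sorted (sort-< u)) (cong [1‥_] (↭-length (sort-↭ I))))))

Λ-Λ⁻¹ : ∀ {I} → Unique I → ∀ {x} → x ∈ I → Λ I (Λ⁻¹ I x) ≡ x
Λ-Λ⁻¹ {I} u {x} x∈ = trans (cong (λ k → at (sort I) (k ∸ 1)) (Λ⁻¹-cong (↭-sym (sort-↭ I)) x))
  (at-rank (sort-< u) (∈-resp-↭ (↭-sym (sort-↭ I)) x∈))

Λ⁻¹-mono-≤ : ∀ I {x y} → x ≤ y → Λ⁻¹ I x ≤ Λ⁻¹ I y
Λ⁻¹-mono-≤ []      _ = z≤n
Λ⁻¹-mono-≤ (z ∷ I) {x} {y} x≤y with z ≤? x | z ≤? y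
... | yes z≤x | yes z≤y rewrite rank-yes {I = I} z≤x | rank-yes {I = I} z≤y = s≤s (Λ⁻¹-mono-≤ I x≤y)
... | yes z≤x | no z≰y  = contradiction (≤-trans z≤x x≤y) z≰y
... | no z≰x  | yes z≤y rewrite rank-no {I = I} z≰x | rank-yes {I = I} z≤y = m≤n⇒m≤1+n (Λ⁻¹-mono-≤ I x≤y)
... | no z≰x  | no z≰y  rewrite rank-no {I = I} z≰x | rank-no {I = I} z≰y = Λ⁻¹-mono-≤ I x≤y

Λ⁻¹-mono-< : ∀ {I x y} → y ∈ I → x < y → Λ⁻¹ I x < Λ⁻¹ I y
Λ⁻¹-mono-< {z ∷ I} (here refl) x<y
  rewrite rank-no {I = I} (<⇒≱ x<y) | rank-yes {z} {z} {I} ≤-refl = s≤s (Λ⁻¹-mono-≤ I (<⇒≤ x<y))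
Λ⁻¹-mono-< {z ∷ I} {x} {y} (there y∈) x<y with z ≤? x | z ≤? y
... | yes z≤x | yes z≤y rewrite rank-yes {I = I} z≤x | rank-yes {I = I} z≤y = s≤s (Λ⁻¹-mono-< y∈ x<y)
... | yes z≤x | no z≰y  = contradiction (≤-trans z≤x (<⇒≤ x<y)) z≰y
... | no z≰x  | yes z≤y rewrite rank-no {I = I} z≰x | rank-yes {I = I} z≤y = m<n⇒m<1+n (Λ⁻¹-mono-< y∈ x<y)
... | no z≰x  | no z≰y  rewrite rank-no {I = I} z≰x | rank-no {I = I} z≰y = Λ⁻¹-mono-< y∈ x<y

WL-length : ∀ {p σ} → WellLabelled p σ → length σ ≡ suc (length p)
WL-length [-]     = refl
WL-length (_ ∷ w) = cong suc (WL-length w)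

WL-drop : ∀ {p σ} k → k < length σ → WellLabelled p σ → WellLabelled (drop k p) (drop k σ)
WL-drop zero    _         w       = w
WL-drop (suc k) (s≤s ())  [-]
WL-drop (suc k) (s≤s k<)  (_ ∷ w) = WL-drop k k< w

WL-take : ∀ {p σ} k → WellLabelled p σ → WellLabelled (take k p) (take (suc k) σ)
WL-take zero    [-]     = [-]
WL-take zero    (_ ∷ _) = [-]
WL-take (suc k) [-]     = [-]
WL-take (suc k) (c ∷ w) = c ∷ WL-take k w

WL-snoc : ∀ {p s y} σ {x} → WellLabelled p (σ ++ x ∷ []) → Compatible s x y →
          WellLabelled (p ++ s ∷ []) ((σ ++ x ∷ []) ++ y ∷ [])
WL-snoc []          [-]     c = c ∷ [-]
WL-snoc (_ ∷ [])    (d ∷ w) c = d ∷ WL-snoc [] w c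
WL-snoc (_ ∷ b ∷ σ) (d ∷ w) c = d ∷ WL-snoc (b ∷ σ) w c

Compatible-neg : ∀ s {x y} → Compatible s x y → Compatible (neg s) y x
Compatible-neg down (f , g) = (λ ()) , λ _ → f refl
Compatible-neg flat (f , g) = (λ ()) , λ ()
Compatible-neg up   (f , g) = (λ _ → g refl) , λ ()

neg-reverse-∷ : ∀ s p → map neg (reverse (s ∷ p)) ≡ map neg (reverse p) ++ neg s ∷ []
neg-reverse-∷ s p = trans (cong (map neg) (unfold-reverse s p)) (map-++ neg (reverse p) (s ∷ []))

WL-reverse : ∀ {p σ} → WellLabelled p σ → WellLabelled (map neg (reverse p)) (reverse σ)
WL-reverse [-] = [-]
WL-reverse {s ∷ p} {x ∷ y ∷ σ} (c ∷ w)
  rewrite neg-reverse-∷ s p | unfold-reverse x (y ∷ σ) | unfold-reverse y σ =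
  WL-snoc (reverse σ) (subst (WellLabelled _) (unfold-reverse y σ) (WL-reverse w)) (Compatible-neg s c)

WL-map : ∀ {p σ} f → (∀ {x y} → x ∈ σ → y ∈ σ → x < y → f x < f y) →
         WellLabelled p σ → WellLabelled p (map f σ)
WL-map f mono [-]               = [-]
WL-map f mono (_∷_ {s} (a , b) w) =
  ((λ e → mono (here refl) (there (here refl)) (a e)) , (λ e → mono (there (here refl)) (here refl) (b e)))
  ∷ WL-map f (λ x∈ y∈ → mono (there x∈) (there y∈)) w

[1‥]-unique : ∀ n → Unique [1‥ n ]
[1‥]-unique n = Uniqueₚ.applyUpTo⁺₁ suc n (λ i<j _ → <⇒≢ (s≤s i<j))

module _ {n : ℕ} (P : WellLabelledPath n) where

  labels-length : length (labels P) ≡ n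
  labels-length = trans (↭-length (permutation P)) (length-applyUpTo suc n)

  size : n ≡ suc (length (steps P))
  size = trans (sym labels-length) (WL-length (wellLabelled P))

  labels-unique : Unique (labels P)
  labels-unique = Unique-↭ (↭-sym (permutation P)) ([1‥]-unique n)

-- The word q with labels λ_I⁻¹(σ₁) λ_I⁻¹(σ₂) ⋯, where I is the set of letters of σ.
standardise : ∀ {m} q I σ → length I ≡ m → Unique I → σ ↭ I → WellLabelled q σ → WellLabelledPath m
standardise {m} q I σ len u σ↭I w = path q (map (Λ⁻¹ I) σ)
  (↭-trans (map⁺ (Λ⁻¹ I) σ↭I) (subst (λ m → map (Λ⁻¹ I) I ↭ [1‥ m ]) len (Λ⁻¹-↭ u)))
  (WL-map (Λ⁻¹ I) (λ _ y∈ → Λ⁻¹-mono-< (∈-resp-↭ σ↭I y∈)) w)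

-- (p′ , σ′) with p′ᵢ = - pₖ₋ᵢ and σ′ᵢ = λ_I′⁻¹(σₖ₊₁₋ᵢ), where I′ = {σ₁ , … , σₖ}
reversedPrefix : ∀ {n} (P : WellLabelledPath n) k → 1 ≤ k → k ≤ n → WellLabelledPath k
reversedPrefix {n} P k 1≤k k≤n =
  standardise (map neg (reverse (take (k ∸ 1) (steps P)))) I′ (reverse I′)
    (trans (length-take k (labels P)) (m≤n⇒m⊓n≡m (subst (k ≤_) (sym (labels-length P)) k≤n)))
    (Uniqueₚ.take⁺ k (labels-unique P))
    (↭-reverse I′)
    (WL-reverse (subst (λ i → WellLabelled (take (k ∸ 1) (steps P)) (take i (labels P)))
      (m+[n∸m]≡n 1≤k) (WL-take (k ∸ 1) (wellLabelled P))))
  where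
  I′ = take k (labels P)

-- (p″ , σ″) with p″ᵢ = pₖ₊ᵢ and σ″ᵢ = λ_I″⁻¹(σₖ₊ᵢ), where I″ = {σₖ₊₁ , … , σₙ}.
-- For k = 1, the set I″ is [n] ∖ {σ₁}.
suffix : ∀ {n} (P : WellLabelledPath n) k → k < n → WellLabelledPath (n ∸ k)
suffix {n} P k k<n =
  standardise (drop k (steps P)) I″ I″
    (trans (length-drop k (labels P)) (cong (_∸ k) (labels-length P)))
    (Uniqueₚ.drop⁺ k (labels-unique P))
    ↭-refl
    (WL-drop k (subst (k <_) (sym (labels-length P)) k<n) (wellLabelled P))
  where
  I″ = drop k (labels P)

sumℤ-++ : ∀ p q → sumℤ (p ++ q) ≡ sumℤ p ℤ.+ sumℤ q
sumℤ-++ []      q = sym (ℤₚ.+-identityˡ (sumℤ q))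
sumℤ-++ (s ∷ p) q = trans (cong (ℤ._+_ (value s)) (sumℤ-++ p q)) (sym (ℤₚ.+-assoc (value s) (sumℤ p) (sumℤ q)))

value-neg : ∀ s → value (neg s) ≡ ℤ.- value s
value-neg down = refl
value-neg flat = refl
value-neg up   = refl

sumℤ-neg-reverse : ∀ p → sumℤ (map neg (reverse p)) ≡ ℤ.- sumℤ p
sumℤ-neg-reverse []      = refl
sumℤ-neg-reverse (s ∷ p) = begin
  sumℤ (map neg (reverse (s ∷ p)))               ≡⟨ cong sumℤ (neg-reverse-∷ s p) ⟩
  sumℤ (map neg (reverse p) ++ neg s ∷ [])       ≡⟨ sumℤ-++ (map neg (reverse p)) (neg s ∷ []) ⟩
  sumℤ (map neg (reverse p)) ℤ.+ (value (neg s) ℤ.+ 0ℤ)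
    ≡⟨ cong₂ ℤ._+_ (sumℤ-neg-reverse p) (trans (ℤₚ.+-identityʳ _) (value-neg s)) ⟩
  ℤ.- sumℤ p ℤ.+ ℤ.- value s                     ≡⟨ ℤₚ.+-comm (ℤ.- sumℤ p) _ ⟩
  ℤ.- value s ℤ.+ ℤ.- sumℤ p                     ≡⟨ sym (ℤₚ.neg-distrib-+ (value s) (sumℤ p)) ⟩
  ℤ.- sumℤ (s ∷ p)                               ∎
  where open ≡-Reasoning

psum-[] : ∀ j → psum [] j ≡ 0ℤ
psum-[] j = cong sumℤ (take-[] j)

psum-+ : ∀ p a b → psum p (a + b) ≡ psum p a ℤ.+ psum (drop a p) b
psum-+ p       zero    b = sym (ℤₚ.+-identityˡ (psum p b))
psum-+ []      (suc a) b = sym (trans (ℤₚ.+-identityˡ (psum [] b)) (psum-[] b))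
psum-+ (s ∷ p) (suc a) b = trans (cong (ℤ._+_ (value s)) (psum-+ p a b))
  (sym (ℤₚ.+-assoc (value s) (psum p a) (psum (drop a p) b)))

take-exact : ∀ {j} (X Y : List Step) → length X ≡ j → take j (X ++ Y) ≡ X
take-exact []      Y refl = refl
take-exact (x ∷ X) Y refl = cong (x ∷_) (take-exact X Y refl)

psum-reverse : ∀ q j → j ≤ length q → psum (map neg (reverse q)) j ℤ.+ sumℤ q ≡ psum q (length q ∸ j)
psum-reverse q j j≤ = begin
  sumℤ (take j (map neg (reverse q))) ℤ.+ sumℤ q
    ≡⟨ cong (λ r → sumℤ (take j (map neg (reverse r))) ℤ.+ sumℤ r) (sym (take++drop≡id i q)) ⟩
  sumℤ (take j (map neg (reverse (A ++ B)))) ℤ.+ sumℤ (A ++ B)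
    ≡⟨ cong₂ ℤ._+_ (cong sumℤ (trans (cong (take j) (trans (cong (map neg) (reverse-++ A B)) (map-++ neg (reverse B) (reverse A))))
        (take-exact (map neg (reverse B)) (map neg (reverse A)) len))) (sumℤ-++ A B) ⟩
  sumℤ (map neg (reverse B)) ℤ.+ (sumℤ A ℤ.+ sumℤ B)
    ≡⟨ cong₂ ℤ._+_ (sumℤ-neg-reverse B) (ℤₚ.+-comm (sumℤ A) (sumℤ B)) ⟩
  ℤ.- sumℤ B ℤ.+ (sumℤ B ℤ.+ sumℤ A)
    ≡⟨ sym (ℤₚ.+-assoc (ℤ.- sumℤ B) (sumℤ B) (sumℤ A)) ⟩
  (ℤ.- sumℤ B ℤ.+ sumℤ B) ℤ.+ sumℤ A
    ≡⟨ cong (ℤ._+ sumℤ A) (ℤₚ.+-inverseˡ (sumℤ B)) ⟩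
  0ℤ ℤ.+ sumℤ A
    ≡⟨ ℤₚ.+-identityˡ (sumℤ A) ⟩
  sumℤ A ∎
  where
  open ≡-Reasoning
  i = length q ∸ j
  A = take i q
  B = drop i q
  len : length (map neg (reverse B)) ≡ j
  len = trans (length-map neg (reverse B)) (trans (length-reverse B) (trans (length-drop i q) (m∸[m∸n]≡n j≤)))

ℤ-cancelˡ-≤ : ∀ k i j → k ℤ.+ i ℤ.≤ k ℤ.+ j → i ℤ.≤ j
ℤ-cancelˡ-≤ k i j h = subst₂ ℤ._≤_ (undo i) (undo j) (ℤₚ.+-monoʳ-≤ (ℤ.- k) h)
  where
  undo : ∀ i → ℤ.- k ℤ.+ (k ℤ.+ i) ≡ i
  undo i = trans (sym (ℤₚ.+-assoc (ℤ.- k) k i)) (trans (cong (ℤ._+ i) (ℤₚ.+-inverseˡ k)) (ℤₚ.+-identityˡ i))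

ℤ-cancelʳ-≤ : ∀ k i j → i ℤ.+ k ℤ.≤ j ℤ.+ k → i ℤ.≤ j
ℤ-cancelʳ-≤ k i j h = ℤ-cancelˡ-≤ k i j (subst₂ ℤ._≤_ (ℤₚ.+-comm i k) (ℤₚ.+-comm j k) h)

step-bounds : ∀ q → -1ℤ ℤ.≤ psum q 1
step-bounds []         = ℤ.-≤+
step-bounds (down ∷ _) = ℤₚ.≤-refl
step-bounds (flat ∷ _) = ℤ.-≤+
step-bounds (up ∷ _)   = ℤ.-≤+

psum-suc-≥ : ∀ p j → psum p j ℤ.+ -1ℤ ℤ.≤ psum p (suc j)
psum-suc-≥ p j = subst (psum p j ℤ.+ -1ℤ ℤ.≤_)
  (trans (sym (psum-+ p j 1)) (cong (psum p) (+-comm j 1)))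
  (ℤₚ.+-monoʳ-≤ (psum p j) (step-bounds (drop j p)))

+-≤-shift : ∀ {k j N} → 1 ≤ j → j ≤ N ∸ k → k + j ≤ N
+-≤-shift {k} {j} {N} 1≤j j≤ = subst (k + j ≤_) (m+[n∸m]≡n {k} {N} k≤N) (+-monoʳ-≤ k j≤)
  where
  k≤N : k ≤ N
  k≤N = <⇒≤ (m∸n≢0⇒n<m {N} {k} (>⇒≢ (≤-trans 1≤j j≤)))

pred≤-1 : ∀ x → x ℤ.+ -1ℤ ℤ.≤ -1ℤ → x ℤ.≤ 0ℤ
pred≤-1 x h = ℤ-cancelʳ-≤ -1ℤ x 0ℤ h

pred≤0 : ∀ x → x ℤ.+ -1ℤ ℤ.≤ 0ℤ → x ℤ.≤ 1ℤ
pred≤0 x h = ℤ-cancelʳ-≤ -1ℤ x 1ℤ h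

0≤∧≢0⇒1≤ : ∀ {x} → 0ℤ ℤ.≤ x → x ≢ 0ℤ → 1ℤ ℤ.≤ x
0≤∧≢0⇒1≤ h ne = ℤₚ.i<j⇒suc[i]≤j (ℤₚ.≤∧≢⇒< h (ne ∘ sym))

1≤∧≢1⇒2≤ : ∀ {x} → 1ℤ ℤ.≤ x → x ≢ 1ℤ → + 2 ℤ.≤ x
1≤∧≢1⇒2≤ h ne = ℤₚ.i<j⇒suc[i]≤j (ℤₚ.≤∧≢⇒< h (ne ∘ sym))

suffix-Motzkin : ∀ {n} p k → k < n → psum p k ≡ 0ℤ → IsMotzkin n p → IsMotzkin (n ∸ k) (drop k p)
suffix-Motzkin {n} p k k<n z (nn , tot) =
  (λ j 1≤j j≤ → subst (0ℤ ℤ.≤_) (shift j) (nn (k + j) (≤-trans 1≤j (m≤n+m j k))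
     (+-≤-shift {k} 1≤j (subst (j ≤_) (trans (∸-+-assoc n k 2) (trans (cong (n ∸_) (+-comm k 2)) (sym (∸-+-assoc n 2 k)))) j≤)))) ,
  trans (sym (shift (n ∸ k ∸ 1))) (trans (cong (psum p) last) tot)
  where
  shift : ∀ j → psum p (k + j) ≡ psum (drop k p) j
  shift j = trans (psum-+ p k j) (trans (cong (ℤ._+ psum (drop k p) j) z) (ℤₚ.+-identityˡ _))
  last : k + (n ∸ k ∸ 1) ≡ n ∸ 1
  last = trans (sym (+-∸-assoc k (m<n⇒0<n∸m k<n))) (cong (_∸ 1) (m+[n∸m]≡n (<⇒≤ k<n)))

suffix-Positive : ∀ {n} p k → (∀ j → 1 ≤ j → k + j ≤ n ∸ 1 → psum p k ℤ.≤ psum p (k + j)) →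
                  IsPositive (n ∸ k) (drop k p)
suffix-Positive {n} p k h j 1≤j j≤ = ℤ-cancelˡ-≤ (psum p k) 0ℤ (psum (drop k p) j)
  (subst₂ ℤ._≤_ (sym (ℤₚ.+-identityʳ _)) (psum-+ p k j)
    (h j 1≤j (+-≤-shift {k} 1≤j (subst (j ≤_) (trans (∸-+-assoc n k 1) (trans (cong (n ∸_) (+-comm k 1)) (sym (∸-+-assoc n 1 k)))) j≤))))

reversed-Motzkin : ∀ p m → 1 ≤ m → m ≤ length p → psum p m ≡ 1ℤ →
                   (∀ i → 1 ≤ i → i < m → 1ℤ ℤ.≤ psum p i) →
                   IsMotzkin (suc m) (map neg (reverse (take m p)))
reversed-Motzkin p m 1≤m m≤ one pos = nn , tot
  where
  q = take m p
  r = map neg (reverse q)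
  lenq : length q ≡ m
  lenq = trans (length-take m p) (m≤n⇒m⊓n≡m m≤)
  key : ∀ j → j ≤ m → psum r j ℤ.+ 1ℤ ≡ psum p (m ∸ j)
  key j j≤m = trans (cong (ℤ._+_ (psum r j)) (sym one))
    (trans (psum-reverse q j (subst (j ≤_) (sym lenq) j≤m))
    (trans (cong (λ l → psum q (l ∸ j)) lenq)
    (cong sumℤ (trans (take-take (m ∸ j) m p) (cong (λ i → take i p) (m≤n⇒m⊓n≡m (m∸n≤m m j)))))))
  nn : ∀ j → 1 ≤ j → j ≤ m ∸ 1 → 0ℤ ℤ.≤ psum r j
  nn j 1≤j j≤ = ℤ-cancelʳ-≤ 1ℤ 0ℤ (psum r j) (subst (1ℤ ℤ.≤_) (sym (key j (<⇒≤ j<m)))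
    (pos (m ∸ j) (m<n⇒0<n∸m j<m) (∸-monoʳ-< {m} {j} {0} 1≤j (<⇒≤ j<m))))
    where
    j<m : j < m
    j<m = ≤-trans (s≤s j≤) (≤-reflexive (trans (sym (+-∸-assoc 1 1≤m)) refl))
  tot : psum r m ≡ -1ℤ
  tot = ℤₚ.≤-antisym (ℤ-cancelʳ-≤ 1ℤ _ _ (ℤₚ.≤-reflexive e)) (ℤ-cancelʳ-≤ 1ℤ _ _ (ℤₚ.≤-reflexive (sym e)))
    where
    e : psum r m ℤ.+ 1ℤ ≡ -1ℤ ℤ.+ 1ℤ
    e = trans (key m ≤-refl) (cong (psum p) (n∸n≡0 m))

record Least (P : ℕ → Set) : Set where
  field
    k       : ℕ
    holds   : P k
    minimal : ∀ {j} → P j → k ≤ j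

record GreatestUpTo (n : ℕ) (P : ℕ → Set) : Set where
  field
    k       : ℕ
    k≤n     : k ≤ n
    holds   : P k
    maximal : ∀ {j} → j ≤ n → P j → j ≤ k

least : ∀ {P} → Decidable P → ∀ {m} → P m → Least P
least {P} P? {m} pm = go m 0 refl (λ _ → z≤n)
  where
  go : ∀ d k → k + d ≡ m → (∀ {j} → P j → k ≤ j) → Least P
  go d k e lower with P? k
  go d       k e lower | yes pk = record { k = k ; holds = pk ; minimal = lower }
  go zero    k e lower | no ¬pk = contradiction (subst P (sym (trans (sym (+-identityʳ k)) e)) pm) ¬pk
  go (suc d) k e lower | no ¬pk = go d (suc k) (trans (sym (+-suc k d)) e)
    (λ pj → ≤∧≢⇒< (lower pj) (λ { refl → ¬pk pj }))

greatest : ∀ {P} → Decidable P → ∀ n {m} → m ≤ n → P m → GreatestUpTo n P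
greatest {P} P? n m≤n pm with P? n
greatest {P} P? n       m≤n pm | yes pn = record { k = n ; k≤n = ≤-refl ; holds = pn ; maximal = λ j≤n _ → j≤n }
greatest {P} P? zero    z≤n pm | no ¬pn = contradiction pm ¬pn
greatest {P} P? (suc n) m≤n pm | no ¬pn = record
  { k = G.k ; k≤n = m≤n⇒m≤1+n G.k≤n ; holds = G.holds ; maximal = λ j≤ pj → G.maximal (below j≤ pj) pj }
  where
  below : ∀ {j} → j ≤ suc n → P j → j ≤ n
  below j≤ pj = s≤s⁻¹ (≤∧≢⇒< j≤ (λ { refl → ¬pn pj }))
  module G = GreatestUpTo (greatest P? n (below m≤n pm) pm)

ReturnsAt : List Step → ℕ → Set
ReturnsAt p k = 1 ≤ k × k ≤ length p × psum p k ≡ 0ℤ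

returnsAt? : ∀ p → Decidable (ReturnsAt p)
returnsAt? p k = (1 ≤? k) ×-dec (k ≤? length p) ×-dec (psum p k ℤ.≟ 0ℤ)

-- ∑ᵢ₌₁ʲ⁻¹ pᵢ ≥ 1 for j = 2 , … , k-1, and ∑ᵢ₌₁ᵏ⁻¹ pᵢ = 1
CutAt : List Step → ℕ → Set
CutAt p k = (∀ {j} → j < k → 2 ≤ j → 1ℤ ℤ.≤ psum p (j ∸ 1)) × psum p (k ∸ 1) ≡ 1ℤ

cutAt? : ∀ p → Decidable (CutAt p)
cutAt? p k = allUpTo? (λ j → (2 ≤? j) →-dec (1ℤ ℤ.≤? psum p (j ∸ 1))) k ×-dec (psum p (k ∸ 1) ℤ.≟ 1ℤ)

module _ {n : ℕ} {p : List Step} (size : n ≡ suc (length (up ∷ p))) (M : IsMotzkin n (up ∷ p)) where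

  private
    s : List Step
    s = up ∷ p

  firstReturn : Least (ReturnsAt s)
  firstReturn = least (returnsAt? s) {length p} (1≤p p M size , n≤1+n _ , zero-before-end)
    where
    1≤p : ∀ p → IsMotzkin n (up ∷ p) → n ≡ suc (suc (length p)) → 1 ≤ length p
    1≤p []      (_ , ()) refl
    1≤p (_ ∷ p) _        _ = s≤s z≤n
    zero-before-end : psum s (length p) ≡ 0ℤ
    zero-before-end = ℤₚ.≤-antisym
      (pred≤-1 (psum s (length p)) (ℤₚ.≤-trans (psum-suc-≥ s (length p))
        (ℤₚ.≤-reflexive (subst (λ n → psum s (n ∸ 1) ≡ -1ℤ) size (proj₂ M)))))
      (proj₁ M (length p) (1≤p p M size) (≤-reflexive (sym (cong (_∸ 2) size))))

  module FirstReturnFacts (R : Least (ReturnsAt s)) where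
    open Least R

    k<n : k < n
    k<n = subst (k <_) (sym size) (s≤s (proj₁ (proj₂ holds)))

    1≤k : 1 ≤ k
    1≤k = proj₁ holds

    zero-at-k : psum s k ≡ 0ℤ
    zero-at-k = proj₂ (proj₂ holds)

    positive-before-k : ∀ i → 1 ≤ i → i < k → 1ℤ ℤ.≤ psum s i
    positive-before-k i 1≤i i<k = 0≤∧≢0⇒1≤
      (proj₁ M i 1≤i (subst (i ≤_) (sym (cong (_∸ 2) size)) (s≤s⁻¹ (≤-trans i<k (proj₁ (proj₂ holds))))))
      (λ z → <⇒≱ i<k (minimal (1≤i , ≤-trans (<⇒≤ i<k) (proj₁ (proj₂ holds)) , z)))

    2≤k : 2 ≤ k
    2≤k = ≤∧≢⇒< 1≤k (λ e → contradiction (trans (cong (psum s) e) zero-at-k) λ ())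

    one-before-k : psum s (k ∸ 1) ≡ 1ℤ
    one-before-k = ℤₚ.≤-antisym
      (pred≤0 _ (ℤₚ.≤-trans (psum-suc-≥ s (k ∸ 1)) (ℤₚ.≤-reflexive (trans (cong (psum s) (m+[n∸m]≡n 1≤k)) zero-at-k))))
      (positive-before-k (k ∸ 1) (∸-monoˡ-≤ 1 2≤k) (≤-reflexive (m+[n∸m]≡n 1≤k)))

    prefix-Motzkin : IsMotzkin k (map neg (reverse (take (k ∸ 1) s)))
    prefix-Motzkin = subst (λ i → IsMotzkin i (map neg (reverse (take (k ∸ 1) s)))) (m+[n∸m]≡n 1≤k)
      (reversed-Motzkin s (k ∸ 1) (∸-monoˡ-≤ 1 2≤k) (≤-trans (m∸n≤m k 1) (proj₁ (proj₂ holds))) one-before-k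
        (λ i 1≤i i< → positive-before-k i 1≤i (≤-trans i< (m∸n≤m k 1))))

    rest-Motzkin : IsMotzkin (n ∸ k) (drop k s)
    rest-Motzkin = suffix-Motzkin s k k<n zero-at-k M

module _ {n : ℕ} {p : List Step} (size : n ≡ suc (length (up ∷ p))) (M : IsPositive n (up ∷ p)) where

  private
    s : List Step
    s = up ∷ p

  lastAtOne : GreatestUpTo n (CutAt s)
  lastAtOne = greatest (cutAt? s) n {2} (subst (2 ≤_) (sym size) (s≤s (s≤s z≤n)))
    ((λ j<2 2≤j → contradiction 2≤j (<⇒≱ j<2)) , refl)

  module LastAtOneFacts (R : GreatestUpTo n (CutAt s)) where
    open GreatestUpTo R

    1≤k∸1 : 1 ≤ k ∸ 1
    1≤k∸1 = n≢0⇒n>0 (λ e → contradiction (trans (sym (cong (psum s) e)) (proj₂ holds)) λ ())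

    1≤k : 1 ≤ k
    1≤k = ≤-trans 1≤k∸1 (m∸n≤m k 1)

    suc-k∸1 : suc (k ∸ 1) ≡ k
    suc-k∸1 = m+[n∸m]≡n 1≤k

    positive-before-k : ∀ i → 1 ≤ i → i < k → 1ℤ ℤ.≤ psum s i
    positive-before-k i 1≤i i<k with i ≟ k ∸ 1
    ... | yes refl = ℤₚ.≤-reflexive (sym (proj₂ holds))
    ... | no  i≢   = proj₁ holds {suc i} (≤∧≢⇒< i<k (λ e → i≢ (cong (_∸ 1) e))) (s≤s 1≤i)

    prefix-Motzkin : IsMotzkin k (map neg (reverse (take (k ∸ 1) s)))
    prefix-Motzkin = subst (λ i → IsMotzkin i (map neg (reverse (take (k ∸ 1) s)))) suc-k∸1
      (reversed-Motzkin s (k ∸ 1) 1≤k∸1 (s≤s⁻¹ (subst₂ _≤_ (sym suc-k∸1) size k≤n)) (proj₂ holds)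
        (λ i 1≤i i< → positive-before-k i 1≤i (≤-trans i< (m∸n≤m k 1))))

    private
      last : ∀ b → b < n → (∀ i → 1 ≤ i → i < b → 1ℤ ℤ.≤ psum s i) → psum s b ≡ 1ℤ → suc b ≤ k
      last b b<n pos e = maximal b<n ((λ { {suc j} (s≤s j<b) (s≤s 1≤j) → pos j 1≤j j<b }) , e)

      psum-k : psum s k ≡ 1ℤ ℤ.+ psum (drop (k ∸ 1) s) 1
      psum-k = trans (cong (psum s) (sym (trans (+-comm (k ∸ 1) 1) suc-k∸1)))
        (trans (psum-+ s (k ∸ 1) 1) (cong (ℤ._+ psum (drop (k ∸ 1) s) 1) (proj₂ holds)))

      step-cases : ∀ q → psum q 1 ≡ -1ℤ ⊎ psum q 1 ≡ 0ℤ ⊎ psum q 1 ≡ 1ℤ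
      step-cases []         = inj₂ (inj₁ refl)
      step-cases (down ∷ _) = inj₁ refl
      step-cases (flat ∷ _) = inj₂ (inj₁ refl)
      step-cases (up ∷ _)   = inj₂ (inj₂ refl)

      below-n : ∀ {i} → i ≤ n ∸ 1 → i < n
      below-n {i} i≤ = subst (i <_) (sym size) (s≤s (subst (i ≤_) (cong (_∸ 1) size) i≤))

      stays-above : psum s k ≡ + 2 → ∀ j → k + j ≤ n ∸ 1 → ∀ i → i ≤ j → + 2 ℤ.≤ psum s (k + i)
      stays-above e zero    _  .zero z≤n = ℤₚ.≤-reflexive (sym (trans (cong (psum s) (+-identityʳ k)) e))
      stays-above e (suc j) b≤ i i≤ with i ≟ suc j
      ... | no  i≢   = stays-above e j (≤-trans (+-monoʳ-≤ k (n≤1+n j)) b≤) i (s≤s⁻¹ (≤∧≢⇒< i≤ i≢))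
      ... | yes refl = 1≤∧≢1⇒2≤ lower (λ z → <⇒≱ (s≤s (m≤m+n k (suc j))) (last (k + suc j) (below-n b≤) earlier z))
        where
        IH : ∀ i → i ≤ j → + 2 ℤ.≤ psum s (k + i)
        IH = stays-above e j (≤-trans (+-monoʳ-≤ k (n≤1+n j)) b≤)
        lower : 1ℤ ℤ.≤ psum s (k + suc j)
        lower = ℤₚ.≤-trans (ℤₚ.+-monoˡ-≤ -1ℤ (IH j ≤-refl))
          (subst (λ b → psum s (k + j) ℤ.+ -1ℤ ℤ.≤ psum s b) (sym (+-suc k j)) (psum-suc-≥ s (k + j)))
        earlier : ∀ i → 1 ≤ i → i < k + suc j → 1ℤ ℤ.≤ psum s i
        earlier i 1≤i i< with i <? k
        ... | yes i<k = positive-before-k i 1≤i i<k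
        ... | no  i≮k = subst (λ i → 1ℤ ℤ.≤ psum s i) (m+[n∸m]≡n k≤i)
          (ℤₚ.≤-trans (ℤ.+≤+ (s≤s z≤n)) (IH (i ∸ k) (s≤s⁻¹ (+-cancelˡ-≤ k _ _
            (subst (_≤ k + suc j) (sym (trans (+-suc k (i ∸ k)) (cong suc (m+[n∸m]≡n k≤i)))) i<)))))
          where
          k≤i : k ≤ i
          k≤i = ≮⇒≥ i≮k

    rest-Positive : k < n → IsPositive (n ∸ k) (drop k s)
    rest-Positive k<n = suffix-Positive {n} s k λ j 1≤j b≤ → case (step-cases (drop (k ∸ 1) s)) j 1≤j b≤
      where
      case : psum (drop (k ∸ 1) s) 1 ≡ -1ℤ ⊎ psum (drop (k ∸ 1) s) 1 ≡ 0ℤ ⊎ psum (drop (k ∸ 1) s) 1 ≡ 1ℤ →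
             ∀ j → 1 ≤ j → k + j ≤ n ∸ 1 → psum s k ℤ.≤ psum s (k + j)
      case (inj₁ e)        j 1≤j b≤ = subst (ℤ._≤ psum s (k + j)) (sym (trans psum-k (cong (ℤ._+_ 1ℤ) e)))
        (M (k + j) (≤-trans 1≤j (m≤n+m j k)) b≤)
      case (inj₂ (inj₁ e)) j 1≤j b≤ = contradiction (last k k<n positive-before-k (trans psum-k (cong (ℤ._+_ 1ℤ) e))) (n≮n k)
      case (inj₂ (inj₂ e)) j 1≤j b≤ = subst (ℤ._≤ psum s (k + j)) (sym two) (stays-above two j b≤ j ≤-refl)
        where
        two : psum s k ≡ + 2
        two = trans psum-k (cong (ℤ._+_ 1ℤ) e)

leaves-relabel : ∀ f t → leaves (relabel f t) ≡ map f (leaves t)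
leaves-relabel f (leaf x)   = refl
leaves-relabel f (node l r) = trans (cong₂ _++_ (leaves-relabel f l) (leaves-relabel f r))
  (sym (map-++ f (leaves l) (leaves r)))

leaves-Λ : ∀ {m} I → length I ≡ m → (T : LabelledTree m) → leaves (relabel (Λ I) (tree T)) ↭ I
leaves-Λ I refl (labelled t t↭) = ↭-trans (↭-reflexive (leaves-relabel (Λ I) t))
  (↭-trans (map⁺ (Λ I) t↭) (Λ-↭ I))

join : ∀ {n a b} I J → I ++ J ↭ [1‥ n ] → length I ≡ a → length J ≡ b →
       LabelledTree a → LabelledTree b → LabelledTree n
join I J IJ lI lJ T U = labelled
  (node (relabel (Λ I) (tree T)) (relabel (Λ J) (tree U)))
  (↭-trans (++⁺ (leaves-Λ I lI T) (leaves-Λ J lJ U)) IJ)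

joinLeaf : ∀ {n b} x J → x ∷ J ↭ [1‥ n ] → length J ≡ b → LabelledTree b → LabelledTree n
joinLeaf x J xJ lJ U = labelled
  (node (leaf x) (relabel (Λ J) (tree U)))
  (↭-trans (++⁺ (↭-refl {x = x ∷ []}) (leaves-Λ J lJ U)) xJ)

module _ {n : ℕ} (P : WellLabelledPath n) (k : ℕ) where

  cut : take k (labels P) ++ drop k (labels P) ↭ [1‥ n ]
  cut = ↭-trans (↭-reflexive (take++drop≡id k (labels P))) (permutation P)

  length-I′ : k ≤ n → length (take k (labels P)) ≡ k
  length-I′ k≤n = trans (length-take k (labels P)) (m≤n⇒m⊓n≡m (subst (k ≤_) (sym (labels-length P)) k≤n))

  length-I″ : length (drop k (labels P)) ≡ n ∸ k
  length-I″ = trans (length-drop k (labels P)) (cong (_∸ k) (labels-length P))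

∸-shrinks : ∀ {n k} → 1 ≤ k → k < n → n ∸ k < n
∸-shrinks {n} {k} 1≤k k<n = ∸-monoʳ-< {n} {k} {0} 1≤k (<⇒≤ k<n)

1<size : ∀ {n l} → n ≡ suc (suc l) → 1 < n
1<size refl = s≤s (s≤s z≤n)

-- The clauses closed by contradiction are not Motzkin; the accessibility
-- argument is recursion on the size.
Φ-acc : ∀ {n} → Acc _<_ n → (P : WellLabelledPath n) → IsMotzkin n (steps P) → LabelledTree n
Φ-acc {n} _ (path [] _ _ _) (_ , total) =
  contradiction (trans (sym (psum-[] (n ∸ 1))) total) λ ()
Φ-acc _ P@(path (down ∷ []) _ _ _) _ =
  labelled (node (leaf 1) (leaf 2)) (↭-reflexive (cong [1‥_] (sym (size P))))
Φ-acc _ P@(path (down ∷ _ ∷ p) _ _ _) (nonneg , _) =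
  contradiction (nonneg 1 ≤-refl (subst (1 ≤_) (sym (cong (_∸ 2) (size P))) (s≤s z≤n))) λ ()
Φ-acc (acc rs) P@(path (flat ∷ p) (x ∷ σ) perm _) M =
  joinLeaf x σ perm (length-I″ P 1)
    (Φ-acc (rs (∸-shrinks ≤-refl 1<n)) (suffix P 1 1<n) (suffix-Motzkin (flat ∷ p) 1 1<n refl M))
  where
  1<n = 1<size (size P)
Φ-acc (acc rs) P@(path (up ∷ p) σ _ _) M =
  join (take k σ) (drop k σ) (cut P k) (length-I′ P k (<⇒≤ k<n)) (length-I″ P k)
    (Φ-acc (rs k<n) (reversedPrefix P k 1≤k (<⇒≤ k<n)) prefix-Motzkin)
    (Φ-acc (rs (∸-shrinks 1≤k k<n)) (suffix P k k<n) rest-Motzkin)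
  where
  R = firstReturn (size P) M
  open Least R using (k)
  open FirstReturnFacts (size P) M R

Φ : ∀ {n} → MotzkinPath n → LabelledTree n
Φ {n} (P , M) = Φ-acc (<-wellFounded n) P M

Φ′-acc : ∀ {n} → Acc _<_ n → (P : WellLabelledPath n) → IsPositive n (steps P) → MarkedTree n

-- The case p₁ = 1; the last argument separates k < n from k = n.
Φ′-up : ∀ {n p σ} → (∀ {m} → m < n → Acc _<_ m) →
        (perm : σ ↭ [1‥ n ]) (wl : WellLabelled (up ∷ p) σ) → IsPositive n (up ∷ p) →
        (R : GreatestUpTo n (CutAt (up ∷ p))) → Dec (GreatestUpTo.k R < n) → MarkedTree n

Φ′-acc _ P@(path [] _ _ _) _ =
  marked (labelled (leaf 1) (↭-reflexive (cong [1‥_] (sym (size P))))) root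
Φ′-acc _ P@(path (down ∷ _) _ _ _) nonneg =
  contradiction (nonneg 1 ≤-refl (subst (1 ≤_) (sym (cong (_∸ 1) (size P))) (s≤s z≤n))) λ ()
Φ′-acc {n} (acc rs) P@(path (flat ∷ p) (x ∷ σ) perm _) M =
  marked (joinLeaf x σ perm (length-I″ P 1) (underlying T)) (right (relabelVertex (Λ σ) (mark T)))
  where
  1<n = 1<size (size P)
  T = Φ′-acc (rs (∸-shrinks ≤-refl 1<n)) (suffix P 1 1<n)
    (suffix-Positive {n} (flat ∷ p) 1 λ j _ → M (suc j) (s≤s z≤n))
Φ′-acc {n} (acc rs) P@(path (up ∷ _) _ perm wl) M = Φ′-up rs perm wl M R (GreatestUpTo.k R <? n)
  where
  R = lastAtOne (size P) M

Φ′-up {n} {p} {σ} _ perm wl M R (no k≮n) =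
  marked (labelled (tree T) (subst (λ m → leaves (tree T) ↭ [1‥ m ]) (≤-antisym k≤n (≮⇒≥ k≮n)) (isLabelled T))) root
  where
  P = path (up ∷ p) σ perm wl
  open GreatestUpTo R using (k; k≤n)
  open LastAtOneFacts (size P) M R
  T = Φ (reversedPrefix P k 1≤k k≤n , prefix-Motzkin)
Φ′-up {n} {p} {σ} rs perm wl M R (yes k<n) =
  marked (join (take k σ) (drop k σ) (cut P k) (length-I′ P k k≤n) (length-I″ P k)
           (Φ (reversedPrefix P k 1≤k k≤n , prefix-Motzkin)) (underlying T))
         (right (relabelVertex (Λ (drop k σ)) (mark T)))
  where
  P = path (up ∷ p) σ perm wl
  open GreatestUpTo R using (k; k≤n)
  open LastAtOneFacts (size P) M R
  T = Φ′-acc (rs (∸-shrinks 1≤k k<n)) (suffix P k k<n) (rest-Positive k<n)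

Φ′ : ∀ {n} → PositivePath n → MarkedTree n
Φ′ {n} (P , M) = Φ′-acc (<-wellFounded n) P M

{-# OPTIONS --safe #-}
module Submission where

-- Two relations describe Φ and Φ′ without standardisation, on arbitrary sets of labels: a path that
-- returns to its starting level is either empty, or starts with a flat step, or reads
-- up, a reversed such path, down, another such path. Cutting a positive path at the last k of
-- case (iii) leaves a positive path, whose junction step is down or up according to the order of the
-- two labels around it; likewise, in Φ, that order says which of the two unordered subtrees comes
-- first. So a tree determines its path. Conversely a path determines its tree, because
-- the cut point is determined by the heights. Order-preserving relabelling transfers this to Φ and Φ′.

open import Defs
open import Data.Integer as ℤ using (0ℤ; 1ℤ; -1ℤ; +_)
import Data.Integer.Properties as ℤₚ
open import Data.List using (List; []; _∷_; _++_; map; length; take; drop; reverse)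
open import Data.List.Properties
open import Data.List.Membership.Propositional using (_∈_)
open import Data.List.Membership.Propositional.Properties using (∈-++⁺ˡ; ∈-++⁺ʳ; ∈-map⁻)
open import Data.List.Relation.Binary.Permutation.Propositional using (_↭_; ↭-refl; ↭-sym; ↭-trans; ↭-reflexive; prep)
open import Data.List.Relation.Binary.Permutation.Propositional.Properties using (++⁺; ++-comm; ↭-reverse; ∈-resp-↭; ↭-singleton-inv)
open import Data.List.Relation.Unary.All as All using ([]; _∷_)
import Data.List.Relation.Unary.All.Properties as Allₚ
open import Data.List.Relation.Unary.AllPairs using ([]; _∷_)
open import Data.List.Relation.Unary.Any using (here; there)
open import Data.List.Relation.Unary.Unique.Propositional using (Unique)
import Data.List.Relation.Unary.AllPairs.Properties as AllPairsₚ
import Data.List.Relation.Unary.Unique.Propositional.Properties as Uniqueₚ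
open import Data.Nat using (ℕ; zero; suc; _∸_; _≤_; _<_; z≤n; s≤s; s≤s⁻¹; NonZero)
open import Data.Nat.Induction using (<-wellFounded)
open import Data.Nat.Properties
open import Data.Product using (Σ; ∃; ∃₂; _×_; _,_; proj₁; proj₂)
open import Function.Structures using (IsBijection)
open import Induction.WellFounded using (Acc; acc)
open import Relation.Binary.Definitions using (tri<; tri≈; tri>)
open import Relation.Binary.PropositionalEquality
open import Relation.Binary.Structures using (IsEquivalence)
open import Relation.Nullary using (¬_; Dec; yes; no; contradiction)

private
  variable
    A : Set
    h i m n x y : ℕ
    s : Step
    p q r : List Step
    σ τ ρ : List ℕ
    t t′ u : Tree

-- Splitting lists and step words.

++-injective : ∀ (as bs : List A) {cs ds} → length as ≡ length bs →
               as ++ cs ≡ bs ++ ds → as ≡ bs × cs ≡ ds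
++-injective []       []       _ e = refl , e
++-injective (a ∷ as) (b ∷ bs) l e
  with refl , e′ ← ∷-injective e
  with refl , e″ ← ++-injective as bs (suc-injective l) e′ = refl , e″

reverse-++-injective : ∀ (as bs : List A) {cs ds} → length as ≡ length bs →
                       reverse as ++ cs ≡ reverse bs ++ ds → as ≡ bs × cs ≡ ds
reverse-++-injective as bs l e
  with e₁ , e₂ ← ++-injective (reverse as) (reverse bs)
         (trans (length-reverse as) (trans l (sym (length-reverse bs)))) e
  = reverse-injective e₁ , e₂

Unique-++⁻ : ∀ (as : List A) {bs} → Unique (as ++ bs) →
             Unique as × Unique bs × (∀ {a b} → a ∈ as → b ∈ bs → a ≢ b)
Unique-++⁻ []       ubs = [] , ubs , λ ()
Unique-++⁻ (a ∷ as) (a∉ ∷ uabs) with uas , ubs , as#bs ← Unique-++⁻ as uabs =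
  (Allₚ.++⁻ˡ as a∉ ∷ uas) , ubs ,
  λ { (here refl) b∈ → All.lookup (Allₚ.++⁻ʳ as a∉) b∈ ; (there a∈) b∈ → as#bs a∈ b∈ }

take++at++drop : ∀ (p : List Step) m → m < length p →
                 ∃ λ s → p ≡ take m p ++ s ∷ drop (suc m) p × psum p (suc m) ≡ psum p m ℤ.+ value s
take++at++drop (s ∷ p) zero    _ = s , refl , trans (ℤₚ.+-identityʳ (value s)) (sym (ℤₚ.+-identityˡ (value s)))
take++at++drop (c ∷ p) (suc m) (s≤s m<) with s , e , e′ ← take++at++drop p m m< =
  s , cong (c ∷_) e , trans (cong (ℤ._+_ (value c)) e′) (sym (ℤₚ.+-assoc (value c) (psum p m) (value s)))

-- Time reversal, nonnegative walks and uniqueness of cuts.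

-- The time reversal p′ᵢ = - pₖ₋ᵢ.
inv : List Step → List Step
inv p = map neg (reverse p)

inv-++ : ∀ p q → inv (p ++ q) ≡ inv q ++ inv p
inv-++ p q = trans (cong (map neg) (reverse-++ p q)) (map-++ neg (reverse q) (reverse p))

neg-involutive : ∀ s → neg (neg s) ≡ s
neg-involutive down = refl
neg-involutive flat = refl
neg-involutive up   = refl

inv-involutive : ∀ p → inv (inv p) ≡ p
inv-involutive p = trans (cong (map neg) (sym (reverse-map neg (reverse p))))
  (trans (sym (map-∘ (reverse (reverse p))))
  (trans (map-cong neg-involutive _) (trans (map-id _) (reverse-involutive p))))

inv-injective : ∀ p q → inv p ≡ inv q → p ≡ q
inv-injective p q e = trans (sym (inv-involutive p)) (trans (cong inv e) (inv-involutive q))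

-- Heights are natural numbers, so staying at or above level 0 is built into the indices and needs
-- no condition on partial sums.
data Walk : ℕ → List Step → ℕ → Set where
  []   : Walk h [] h
  down : Walk h p i → Walk (suc h) (down ∷ p) i
  flat : Walk h p i → Walk h (flat ∷ p) i
  up   : Walk (suc h) p i → Walk h (up ∷ p) i

Walk-++ : Walk h p i → Walk i q m → Walk h (p ++ q) m
Walk-++ []       v = v
Walk-++ (down w) v = down (Walk-++ w v)
Walk-++ (flat w) v = flat (Walk-++ w v)
Walk-++ (up w)   v = up (Walk-++ w v)

Walk-suc : Walk h p i → Walk (suc h) p (suc i)
Walk-suc []       = []
Walk-suc (down w) = down (Walk-suc w)
Walk-suc (flat w) = flat (Walk-suc w)
Walk-suc (up w)   = up (Walk-suc w)

Walk-inv : Walk h p i → Walk i (inv p) h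
Walk-inv [] = []
Walk-inv (down {p = p} w) rewrite neg-reverse-∷ down p = Walk-++ (Walk-inv w) (up [])
Walk-inv (flat {p = p} w) rewrite neg-reverse-∷ flat p = Walk-++ (Walk-inv w) (flat [])
Walk-inv (up {p = p} w)   rewrite neg-reverse-∷ up p   = Walk-++ (Walk-inv w) (down [])

Walk-end : Walk h p i → Walk h p m → i ≡ m
Walk-end []       []       = refl
Walk-end (down w) (down v) = Walk-end w v
Walk-end (flat w) (flat v) = Walk-end w v
Walk-end (up w)   (up v)   = Walk-end w v

-- Turns the bound built into `Walk` back into partial sums; at `h` = 0 it gives the inequalities of
-- `IsPositive`.
Walk-psum : Walk h p i → ∀ j → 0ℤ ℤ.≤ + h ℤ.+ psum p j
Walk-psum {h} w zero = subst (0ℤ ℤ.≤_) (sym (ℤₚ.+-identityʳ (+ h))) (ℤ.+≤+ z≤n)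
Walk-psum {h} [] (suc j) = subst (0ℤ ℤ.≤_) (sym (ℤₚ.+-identityʳ (+ h))) (ℤ.+≤+ z≤n)
Walk-psum {suc h} (down {p = p} w) (suc j) =
  subst (0ℤ ℤ.≤_) (ℤₚ.+-assoc (+ suc h) -1ℤ (psum p j)) (Walk-psum w j)
Walk-psum {h} (flat {p = p} w) (suc j) =
  subst (λ z → 0ℤ ℤ.≤ + h ℤ.+ z) (sym (ℤₚ.+-identityˡ (psum p j))) (Walk-psum w j)
Walk-psum {h} (up {p = p} w) (suc j) =
  subst (0ℤ ℤ.≤_) (trans (cong (λ i → + i ℤ.+ psum p j) (+-comm 1 h)) (ℤₚ.+-assoc (+ h) 1ℤ (psum p j)))
    (Walk-psum w j)

-- Started one level lower, a walk down to 0 would go below 0.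
¬Walk-pred : Walk (suc h) p 0 → ¬ Walk h (p ++ q) i
¬Walk-pred (down {h = suc _} w) (down v) = ¬Walk-pred w v
¬Walk-pred (flat w) (flat v) = ¬Walk-pred w v
¬Walk-pred (up w)   (up v)   = ¬Walk-pred w v

¬Walk-++-down : Walk h p 0 → ¬ Walk h (p ++ down ∷ q) i
¬Walk-++-down {p = p} {q = q} w v =
  ¬Walk-pred (Walk-++ (Walk-suc w) (down [])) (subst (λ z → Walk _ z _) (sym (++-assoc p (down ∷ []) q)) v)

-- The marked `down` is the first step to go below level 0, so the word alone locates it, whatever
-- follows.
down-cut-unique : Walk h p 0 → Walk h q 0 → ∀ {p′ q′} →
                  p ++ down ∷ p′ ≡ q ++ down ∷ q′ → p ≡ q × p′ ≡ q′
down-cut-unique []       []       e = refl , ∷-injectiveʳ e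
down-cut-unique []       (flat v) ()
down-cut-unique []       (up v)   ()
down-cut-unique (flat w) []       ()
down-cut-unique (up w)   []       ()
down-cut-unique (down w) (down v) e with refl , e′ ← down-cut-unique w v (∷-injectiveʳ e) = refl , e′
down-cut-unique (down w) (flat v) ()
down-cut-unique (down w) (up v)   ()
down-cut-unique (flat w) (down v) ()
down-cut-unique (flat w) (flat v) e with refl , e′ ← down-cut-unique w v (∷-injectiveʳ e) = refl , e′
down-cut-unique (flat w) (up v)   ()
down-cut-unique (up w)   (down v) ()
down-cut-unique (up w)   (flat v) ()
down-cut-unique (up w)   (up v)   e with refl , e′ ← down-cut-unique w v (∷-injectiveʳ e) = refl , e′

-- The marked `up` is the last passage from level 0 to level 1. This depends on what follows: a
-- later cut would require another visit to level 0, and neither `p′` nor `q′` goes below its own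
-- starting level.
up-cut-unique : Walk h p 0 → Walk h q 0 → ∀ {p′ q′} → Walk 0 p′ i → Walk 0 q′ m →
                p ++ up ∷ p′ ≡ q ++ up ∷ q′ → p ≡ q × p′ ≡ q′
up-cut-unique []       []       w′ v′ e = refl , ∷-injectiveʳ e
up-cut-unique []       (flat v) w′ v′ ()
up-cut-unique []       (up v)   w′ v′ e =
  contradiction (subst (λ z → Walk 0 z _) (∷-injectiveʳ e) w′) (¬Walk-pred v)
up-cut-unique (flat w) []       w′ v′ ()
up-cut-unique (up w)   []       w′ v′ e =
  contradiction (subst (λ z → Walk 0 z _) (sym (∷-injectiveʳ e)) v′) (¬Walk-pred w)
up-cut-unique (down w) (down v) w′ v′ e with refl , e′ ← up-cut-unique w v w′ v′ (∷-injectiveʳ e) = refl , e′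
up-cut-unique (down w) (flat v) w′ v′ ()
up-cut-unique (down w) (up v)   w′ v′ ()
up-cut-unique (flat w) (down v) w′ v′ ()
up-cut-unique (flat w) (flat v) w′ v′ e with refl , e′ ← up-cut-unique w v w′ v′ (∷-injectiveʳ e) = refl , e′
up-cut-unique (flat w) (up v)   w′ v′ ()
up-cut-unique (up w)   (down v) w′ v′ ()
up-cut-unique (up w)   (flat v) w′ v′ ()
up-cut-unique (up w)   (up v)   w′ v′ e with refl , e′ ← up-cut-unique w v w′ v′ (∷-injectiveʳ e) = refl , e′

-- Gluing and cutting well-labelled words.

WL-++ : ∀ σ → WellLabelled p (σ ++ x ∷ []) → Compatible s x y → WellLabelled q (y ∷ τ) →
        WellLabelled (p ++ s ∷ q) ((σ ++ x ∷ []) ++ y ∷ τ)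
WL-++ []          [-]     c w = c ∷ w
WL-++ (_ ∷ [])    (d ∷ v) c w = d ∷ WL-++ [] v c w
WL-++ (_ ∷ b ∷ σ) (d ∷ v) c w = d ∷ WL-++ (b ∷ σ) v c w

-- Reversal moves the first label `x` to the end, so the junction step compares the first labels of
-- the two pieces.
WL-reverse-++ : WellLabelled p (reverse (x ∷ σ)) → Compatible s x y → WellLabelled q (y ∷ τ) →
                WellLabelled (p ++ s ∷ q) (reverse (x ∷ σ) ++ y ∷ τ)
WL-reverse-++ {x = x} {σ = σ} rewrite unfold-reverse x σ = WL-++ (reverse σ)

-- The length condition aligns the two cuts: it puts `s` between the last label of `ρ` and the first
-- label of `τ`.
WL-cut : ∀ p {ρ} → WellLabelled (p ++ s ∷ q) (ρ ++ τ) → length ρ ≡ suc (length p) →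
         ∃ λ ρ′ → ∃ λ x → ∃ λ y → ∃ λ τ′ → ρ ≡ ρ′ ++ x ∷ [] × τ ≡ y ∷ τ′ × Compatible s x y
WL-cut {τ = y ∷ τ} [] {x ∷ []} (c ∷ w) refl = [] , x , y , τ , refl , refl , c
WL-cut {τ = []} [] {_ ∷ []} () _
WL-cut (_ ∷ p) {z ∷ z′ ∷ ρ} (_ ∷ w) e
  with ρ′ , x , y , τ′ , e₁ , e₂ , c ← WL-cut p {z′ ∷ ρ} w (suc-injective e) =
  z ∷ ρ′ , x , y , τ′ , cong (z ∷_) e₁ , e₂ , c

WL-reverse-cut : ∀ p → WellLabelled (p ++ s ∷ q) (ρ ++ τ) → length ρ ≡ suc (length p) →
                 ∃₂ λ x σ → ∃₂ λ y τ′ → reverse ρ ≡ x ∷ σ × τ ≡ y ∷ τ′ × Compatible s x y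
WL-reverse-cut p w l with ρ′ , x , y , τ′ , e₁ , e₂ , c ← WL-cut p w l =
  x , reverse ρ′ , y , τ′ , trans (cong reverse e₁) (reverse-++ ρ′ (x ∷ [])) , e₂ , c

-- Isomorphisms of trees and transport of the mark.

≅-refl : t ≅ t
≅-refl {leaf x}   = leaf
≅-refl {node l r} = node ≅-refl ≅-refl

≅-sym : t ≅ u → u ≅ t
≅-sym leaf       = leaf
≅-sym (node f g) = node (≅-sym f) (≅-sym g)
≅-sym (swap f g) = swap (≅-sym g) (≅-sym f)

≅-trans : t ≅ u → u ≅ t′ → t ≅ t′
≅-trans leaf       leaf         = leaf
≅-trans (node f g) (node f′ g′) = node (≅-trans f f′) (≅-trans g g′)
≅-trans (node f g) (swap f′ g′) = swap (≅-trans f f′) (≅-trans g g′)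
≅-trans (swap f g) (node f′ g′) = swap (≅-trans f g′) (≅-trans g f′)
≅-trans (swap f g) (swap f′ g′) = node (≅-trans f g′) (≅-trans g f′)

transport-refl : (v : Vertex t) → transport ≅-refl v ≡ v
transport-refl root      = refl
transport-refl (left v)  = cong left (transport-refl v)
transport-refl (right v) = cong right (transport-refl v)

transport-sym : (f : t ≅ u) (v : Vertex t) → transport (≅-sym f) (transport f v) ≡ v
transport-sym leaf       root      = refl
transport-sym (node f g) root      = refl
transport-sym (swap f g) root      = refl
transport-sym (node f g) (left v)  = cong left (transport-sym f v)
transport-sym (node f g) (right v) = cong right (transport-sym g v)
transport-sym (swap f g) (left v)  = cong left (transport-sym f v)
transport-sym (swap f g) (right v) = cong right (transport-sym g v)

transport-trans : (f : t ≅ u) (g : u ≅ t′) (v : Vertex t) →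
                  transport (≅-trans f g) v ≡ transport g (transport f v)
transport-trans leaf       leaf         root      = refl
transport-trans (node f g) (node f′ g′) root      = refl
transport-trans (node f g) (swap f′ g′) root      = refl
transport-trans (swap f g) (node f′ g′) root      = refl
transport-trans (swap f g) (swap f′ g′) root      = refl
transport-trans (node f g) (node f′ g′) (left v)  = cong left (transport-trans f f′ v)
transport-trans (node f g) (node f′ g′) (right v) = cong right (transport-trans g g′ v)
transport-trans (node f g) (swap f′ g′) (left v)  = cong right (transport-trans f f′ v)
transport-trans (node f g) (swap f′ g′) (right v) = cong left (transport-trans g g′ v)
transport-trans (swap f g) (node f′ g′) (left v)  = cong right (transport-trans f g′ v)
transport-trans (swap f g) (node f′ g′) (right v) = cong left (transport-trans g f′ v)
transport-trans (swap f g) (swap f′ g′) (left v)  = cong left (transport-trans f g′ v)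
transport-trans (swap f g) (swap f′ g′) (right v) = cong right (transport-trans g f′ v)

≅-leaves : t ≅ u → leaves t ↭ leaves u
≅-leaves leaf = ↭-refl
≅-leaves (node f g) = ++⁺ (≅-leaves f) (≅-leaves g)
≅-leaves {u = node l′ r′} (swap f g) =
  ↭-trans (++⁺ (≅-leaves f) (≅-leaves g)) (++-comm (leaves r′) (leaves l′))

-- Codes of unmarked trees.

-- Codes q σ t says that Φ (q ++ down , σ) = t, for an arbitrary set of labels instead of [n].
data Codes : List Step → List ℕ → Tree → Set where
  cherry : x < y → Codes [] (x ∷ y ∷ []) (node (leaf x) (leaf y))
  flat   : Codes q σ t → Codes (flat ∷ q) (x ∷ σ) (node (leaf x) t)
  graft  : Codes q (x ∷ σ) t → Codes r (y ∷ τ) u → x < y →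
           p ≡ up ∷ inv q ++ down ∷ r → ρ ≡ reverse (x ∷ σ) ++ y ∷ τ →
           Codes p ρ (node t u)

Codes-resp : σ ≡ τ → Codes q σ t → Codes q τ t
Codes-resp refl c = c

Codes-Walk : Codes q σ t → Walk 0 q 0
Codes-Walk (cherry _) = []
Codes-Walk (flat c)   = flat (Codes-Walk c)
Codes-Walk (graft c d _ refl _) = up (Walk-++ (Walk-suc (Walk-inv (Codes-Walk c))) (down (Codes-Walk d)))

Codes-WL : Codes q σ t → WellLabelled (q ++ down ∷ []) σ
Codes-WL-inv : Codes q σ t → WellLabelled (up ∷ inv q) (reverse σ)

Codes-WL (cherry x<y) = ((λ _ → x<y) , λ ()) ∷ [-]
-- Of the three constructors, only `graft` does not show in its index that the label list is
-- nonempty; its equation for the labels does, by length.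
Codes-WL (flat {σ = []} (graft {x = x} {σ = σ} {y = y} {τ = τ} _ _ _ _ e)) =
  contradiction (trans (cong length e) (trans (length-++ (reverse (x ∷ σ))) (+-suc _ (length τ)))) λ ()
Codes-WL (flat {σ = _ ∷ _} c) = ((λ ()) , λ ()) ∷ Codes-WL c
Codes-WL (graft {q} {σ = σ} {r = r} c d x<y refl refl)
  rewrite ++-assoc (inv q) (down ∷ r) (down ∷ []) =
  WL-reverse-++ {σ = σ} (Codes-WL-inv c) ((λ _ → x<y) , λ ()) (Codes-WL d)

Codes-WL-inv {q} {σ} c = subst (λ z → WellLabelled z (reverse σ)) (inv-++ q (down ∷ [])) (WL-reverse (Codes-WL c))

Codes-length : Codes q σ t → length σ ≡ suc (suc (length q))
Codes-length {q} c = trans (WL-length (Codes-WL c)) (cong suc (trans (length-++ q) (+-comm (length q) 1)))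

reverse-++-↭ : ∀ (σ : List A) {σ′ τ τ′} → σ ↭ σ′ → τ ↭ τ′ → reverse σ ++ τ ↭ σ′ ++ τ′
reverse-++-↭ σ a b = ++⁺ (↭-trans (↭-reverse σ) a) b

Codes-leaves : Codes q σ t → σ ↭ leaves t
Codes-leaves (cherry _) = ↭-refl
Codes-leaves (flat {x = x} c) = prep x (Codes-leaves c)
Codes-leaves (graft {x = x} {σ = σ} c d _ _ refl) = reverse-++-↭ (x ∷ σ) (Codes-leaves c) (Codes-leaves d)

-- In a `graft`, `inv q` starts and ends at level 0 and the next step is `down`, so
-- `down-cut-unique` recovers `q`. The length of `q` fixes the number of labels in the prefix, which
-- cuts the label list.
Codes-functional : Codes q σ t → Codes q σ u → t ≡ u
Codes-functional (cherry _) (cherry _) = refl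
Codes-functional (cherry _) (graft _ _ _ () _)
Codes-functional (flat c) (flat d) = cong (node _) (Codes-functional c d)
Codes-functional (flat _) (graft _ _ _ () _)
Codes-functional (graft _ _ _ () _) (cherry _)
Codes-functional (graft _ _ _ () _) (flat _)
Codes-functional (graft {q} {x} {σ} c d _ e₁ e₂) (graft {q′} {x′} {σ′} c′ d′ _ e₁′ e₂′)
  with inv≡ , refl ← down-cut-unique (Walk-inv (Codes-Walk c)) (Walk-inv (Codes-Walk c′))
                       (∷-injectiveʳ (trans (sym e₁) e₁′))
  with refl ← inv-injective q q′ inv≡
  with refl , refl ← reverse-++-injective (x ∷ σ) (x′ ∷ σ′)
                         (trans (Codes-length c) (sym (Codes-length c′))) (trans (sym e₂) e₂′)
  = cong₂ node (Codes-functional c c′) (Codes-functional d d′)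

¬Codes-leaf : ∀ {a} → Codes q σ t → ¬ leaf a ≅ t
¬Codes-leaf (cherry _)       ()
¬Codes-leaf (flat _)         ()
¬Codes-leaf (graft _ _ _ _ _) ()

¬Codes-leaf′ : ∀ {a} → Codes q σ t → ¬ t ≅ leaf a
¬Codes-leaf′ c f = ¬Codes-leaf c (≅-sym f)

-- A coded tree is never a leaf, so the number of leaves among the children of the root (two, one or
-- none) determines the constructor.
Codes-injective : Codes q σ t → Codes r τ u → t ≅ u → q ≡ r × σ ≡ τ
Codes-injective (cherry _)   (cherry _)   (node leaf leaf) = refl , refl
Codes-injective (cherry x<y) (cherry y<x) (swap leaf leaf) = contradiction x<y (<-asym y<x)
Codes-injective (cherry _)   (flat c)     (node _ g) = contradiction g (¬Codes-leaf c)
Codes-injective (cherry _)   (flat c)     (swap f _) = contradiction f (¬Codes-leaf c)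
Codes-injective (cherry _)   (graft c _ _ _ _) (node f _) = contradiction f (¬Codes-leaf c)
Codes-injective (cherry _)   (graft c _ _ _ _) (swap _ g) = contradiction g (¬Codes-leaf c)
Codes-injective (flat c)     (cherry _)   (node _ g) = contradiction g (¬Codes-leaf′ c)
Codes-injective (flat c)     (cherry _)   (swap _ g) = contradiction g (¬Codes-leaf′ c)
Codes-injective (flat c)     (flat d)     (node leaf g) with refl , refl ← Codes-injective c d g = refl , refl
Codes-injective (flat _)     (flat d)     (swap f _) = contradiction f (¬Codes-leaf d)
Codes-injective (flat _)     (graft c _ _ _ _) (node f _) = contradiction f (¬Codes-leaf c)
Codes-injective (flat _)     (graft _ d _ _ _) (swap f _) = contradiction f (¬Codes-leaf d)
Codes-injective (graft c _ _ _ _) (cherry _) (node f _) = contradiction f (¬Codes-leaf′ c)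
Codes-injective (graft c _ _ _ _) (cherry _) (swap f _) = contradiction f (¬Codes-leaf′ c)
Codes-injective (graft c _ _ _ _) (flat _)   (node f _) = contradiction f (¬Codes-leaf′ c)
Codes-injective (graft _ d _ _ _) (flat _)   (swap _ g) = contradiction g (¬Codes-leaf′ d)
Codes-injective (graft c d _ refl refl) (graft c′ d′ _ refl refl) (node f g)
  with refl , refl ← Codes-injective c c′ f
  with refl , refl ← Codes-injective d d′ g = refl , refl
-- Exchanged subtrees have equal codes, hence equal first labels, which would then be ordered both
-- ways.
Codes-injective (graft c d x<y _ _) (graft c′ d′ y<x _ _) (swap f g)
  with refl , refl ← Codes-injective c d′ f
  with refl , refl ← Codes-injective d c′ g = contradiction x<y (<-asym y<x)

-- The coded tree agrees with `t` only up to exchanging children. The label list is displayed with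
-- its head because the head decides the order of the subtrees in `graft`.
record Coded (t : Tree) : Set where
  field
    {word}  : List Step
    {first} : ℕ
    {rest}  : List ℕ
    {shape} : Tree
    codes   : Codes word (first ∷ rest) shape
    iso     : shape ≅ t

  first∈ : first ∈ leaves t
  first∈ = ∈-resp-↭ (↭-trans (Codes-leaves codes) (≅-leaves iso)) (here refl)

module C = Coded

coded : Codes q σ u → u ≅ t → Coded t
coded {σ = []}    c f = contradiction (Codes-length c) λ ()
coded {σ = _ ∷ _} c f = record { codes = c ; iso = f }

-- The subtree coded by the path with the smaller first label is the reversed prefix.
Coded-node : (C : Coded t) (D : Coded u) → C.first C ≢ C.first D → Coded (node t u)
Coded-node C D ≢ with <-cmp (C.first C) (C.first D)
... | tri< x<y _ _ = coded (graft (C.codes C) (C.codes D) x<y refl refl) (node (C.iso C) (C.iso D))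
... | tri≈ _ e _   = contradiction e ≢
... | tri> _ _ y<x = coded (graft (C.codes D) (C.codes C) y<x refl refl) (swap (C.iso D) (C.iso C))

-- A single leaf has no code, hence the restriction to a `node` at the root. Distinct leaf labels
-- make the first labels of the two subtrees strictly comparable.
Codes-surjective : ∀ l r → Unique (leaves (node l r)) → Coded (node l r)
Codes-surjective (leaf x) (leaf y) ((x≢y ∷ []) ∷ _) with <-cmp x y
... | tri< x<y _ _ = coded (cherry x<y) ≅-refl
... | tri≈ _ e _   = contradiction e x≢y
... | tri> _ _ y<x = coded (cherry y<x) (swap leaf leaf)
Codes-surjective (leaf x) (node r₁ r₂) (_ ∷ u) = coded (flat (C.codes C)) (node leaf (C.iso C))
  where C = Codes-surjective r₁ r₂ u
Codes-surjective (node l₁ l₂) (leaf x) u = coded (flat (C.codes C)) (swap leaf (C.iso C))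
  where C = Codes-surjective l₁ l₂ (proj₁ (Unique-++⁻ (leaves (node l₁ l₂)) u))
Codes-surjective l@(node l₁ l₂) (node r₁ r₂) u with ul , ur , l#r ← Unique-++⁻ (leaves l) u =
  Coded-node C D (l#r (C.first∈ C) (C.first∈ D))
  where
  C = Codes-surjective l₁ l₂ ul
  D = Codes-surjective r₁ r₂ ur

-- Monotonicity is asked only on the labels that occur, since `Λ I` takes the junk value 0 out of
-- range.
StrictlyMonoOn : List ℕ → (ℕ → ℕ) → Set
StrictlyMonoOn σ f = ∀ {x y} → x ∈ σ → y ∈ σ → x < y → f x < f y

∈-reverse-++ : ∀ σ → x ∈ σ → x ∈ reverse σ ++ τ
∈-reverse-++ σ x∈ = ∈-++⁺ˡ (∈-resp-↭ (↭-sym (↭-reverse σ)) x∈)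

map-reverse-++ : ∀ (f : ℕ → ℕ) σ τ → map f (reverse σ ++ τ) ≡ reverse (map f σ) ++ map f τ
map-reverse-++ f σ τ = trans (map-++ f (reverse σ) τ) (cong (_++ map f τ) (reverse-map f σ))

Codes-relabel : ∀ f → StrictlyMonoOn σ f → Codes q σ t → Codes q (map f σ) (relabel f t)
Codes-relabel f mono (cherry x<y) = cherry (mono (here refl) (there (here refl)) x<y)
Codes-relabel f mono (flat c)     = flat (Codes-relabel f (λ a b → mono (there a) (there b)) c)
Codes-relabel f mono (graft {x = x} {σ = σ} {y = y} {τ = τ} c d x<y e refl) =
  graft (Codes-relabel f (λ a b → mono (inˡ a) (inˡ b)) c) (Codes-relabel f (λ a b → mono (inʳ a) (inʳ b)) d)
    (mono (inˡ (here refl)) (inʳ (here refl)) x<y) e (map-reverse-++ f (x ∷ σ) (y ∷ τ))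
  where
  inˡ : ∀ {z} → z ∈ x ∷ σ → z ∈ reverse (x ∷ σ) ++ y ∷ τ
  inˡ = ∈-reverse-++ (x ∷ σ)
  inʳ : ∀ {z} → z ∈ y ∷ τ → z ∈ reverse (x ∷ σ) ++ y ∷ τ
  inʳ = ∈-++⁺ʳ (reverse (x ∷ σ))

-- Codes of marked trees.

-- The junction step of case (iii) of Φ′ is forced by the labels around it.
data Junction : Step → ℕ → ℕ → Set where
  down : x < y → Junction down x y
  up   : y < x → Junction up x y

Junction-Compatible : Junction s x y → Compatible s x y
Junction-Compatible (down x<y) = (λ _ → x<y) , λ ()
Junction-Compatible (up y<x)   = (λ ()) , λ _ → y<x

Junction-relabel : ∀ f → StrictlyMonoOn σ f → x ∈ σ → y ∈ σ → Junction s x y → Junction s (f x) (f y)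
Junction-relabel f mono x∈ y∈ (down x<y) = down (mono x∈ y∈ x<y)
Junction-relabel f mono x∈ y∈ (up y<x)   = up (mono y∈ x∈ y<x)

Junction-unique : ∀ {s s′} → Junction s x y → Junction s′ x y → s ≡ s′
Junction-unique (down _)   (down _)   = refl
Junction-unique (down x<y) (up y<x)   = contradiction x<y (<-asym y<x)
Junction-unique (up y<x)   (down x<y) = contradiction x<y (<-asym y<x)
Junction-unique (up _)     (up _)     = refl

Junction-exists : x ≢ y → ∃ λ s → Junction s x y
Junction-exists {x} {y} x≢y with <-cmp x y
... | tri< x<y _ _ = down , down x<y
... | tri≈ _ e _   = contradiction e x≢y
... | tri> _ _ y<x = up , up y<x

-- Codes• p σ t v says that Φ′ (p , σ) is the tree t marked at v, again for arbitrary labels.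
data Codes• : List Step → List ℕ → (t : Tree) → Vertex t → Set where
  single : Codes• [] (x ∷ []) (leaf x) root
  flat   : ∀ {v} → Codes• p σ t v → Codes• (flat ∷ p) (x ∷ σ) (node (leaf x) t) (right v)
  atRoot : Codes q σ t → p ≡ up ∷ inv q → ρ ≡ reverse σ → Codes• p ρ t root
  graft  : ∀ {v} → Codes q (x ∷ σ) t → Codes• r (y ∷ τ) u v → Junction s x y →
           p ≡ up ∷ inv q ++ s ∷ r → ρ ≡ reverse (x ∷ σ) ++ y ∷ τ →
           Codes• p ρ (node t u) (right v)

private
  variable
    v : Vertex t
    w : Vertex u

Codes•-resp : σ ≡ τ → Codes• p σ t v → Codes• p τ t v
Codes•-resp refl c = c

Codes•-Walk : Codes• p σ t v → ∃ (Walk 0 p)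
Codes•-Walk single = 0 , []
Codes•-Walk (flat c) with k , w ← Codes•-Walk c = k , flat w
Codes•-Walk (atRoot c refl _) = 1 , up (Walk-suc (Walk-inv (Codes-Walk c)))
Codes•-Walk (graft c d j refl _) with k , w ← Codes•-Walk d with j
-- The prefix stops at level 1, so the rest starts at level 0 after `down` and at level 2 after
-- `up`.
... | down _ = k , up (Walk-++ (Walk-suc (Walk-inv (Codes-Walk c))) (down w))
... | up _   = suc (suc k) , up (Walk-++ (Walk-suc (Walk-inv (Codes-Walk c))) (up (Walk-suc (Walk-suc w))))

Codes•-leaves : Codes• p σ t v → σ ↭ leaves t
Codes•-leaves single = ↭-refl
Codes•-leaves (flat {x = x} c) = prep x (Codes•-leaves c)
Codes•-leaves (atRoot {σ = σ} c _ refl) = ↭-trans (↭-reverse σ) (Codes-leaves c)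
Codes•-leaves (graft {x = x} {σ = σ} c d _ _ refl) = reverse-++-↭ (x ∷ σ) (Codes-leaves c) (Codes•-leaves d)

leaves-nonempty : ∀ t → ∃₂ λ x σ → leaves t ≡ x ∷ σ
leaves-nonempty (leaf x) = x , [] , refl
leaves-nonempty (node l r) with x , σ , e ← leaves-nonempty l = x , σ ++ leaves r , cong (_++ leaves r) e

↭-leaves-∷ : ∀ t → σ ↭ leaves t → ∃₂ λ x τ → σ ≡ x ∷ τ
↭-leaves-∷ {x ∷ σ} _ _ = x , σ , refl
↭-leaves-∷ {[]} t []↭ with x , σ , e ← leaves-nonempty t
  with () ← ∈-resp-↭ (↭-sym (↭-trans []↭ (↭-reflexive e))) (here refl)

Codes•-WL : Codes• p σ t v → WellLabelled p σ
Codes•-WL single = [-]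
Codes•-WL (flat {t = t} c) with _ , _ , refl ← ↭-leaves-∷ t (Codes•-leaves c) = ((λ ()) , λ ()) ∷ Codes•-WL c
Codes•-WL (atRoot c refl refl) = Codes-WL-inv c
Codes•-WL (graft {σ = σ} c d j refl refl) =
  WL-reverse-++ {σ = σ} (Codes-WL-inv c) (Junction-Compatible j) (Codes•-WL d)

-- A `down` cut takes the word below its starting level and an `up` cut never does, so both kinds
-- cannot occur in the same word.
junction-cut-unique : ∀ {s s′ p′ q′ x′ y′} → Walk 0 p 0 → Walk 0 q 0 → Walk 0 p′ i → Walk 0 q′ m →
                      Junction s x y → Junction s′ x′ y′ →
                      p ++ s ∷ p′ ≡ q ++ s′ ∷ q′ → p ≡ q × p′ ≡ q′
junction-cut-unique w v w′ v′ (down _) (down _) e = down-cut-unique w v e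
junction-cut-unique w v w′ v′ (up _)   (up _)   e = up-cut-unique w v w′ v′ e
junction-cut-unique w v w′ v′ (down _) (up _)   e =
  contradiction (subst (λ z → Walk 0 z _) (sym e) (Walk-++ v (up (Walk-suc v′)))) (¬Walk-++-down w)
junction-cut-unique w v w′ v′ (up _)   (down _) e =
  contradiction (subst (λ z → Walk 0 z _) e (Walk-++ w (up (Walk-suc w′)))) (¬Walk-++-down v)

-- Separates `atRoot` from `graft`: `q` stays nonnegative, which excludes a `down` after `p`, and
-- ends at level 0, which excludes an `up` after which the word stays at level 1 or higher.
no-junction : ∀ {p′} → Walk 0 p 0 → Walk 0 q 0 → Walk 0 p′ i → Junction s x y → q ≢ p ++ s ∷ p′
no-junction w v w′ (down _) refl = ¬Walk-++-down w v
no-junction w v w′ (up _)   refl with () ← Walk-end v (Walk-++ w (up (Walk-suc w′)))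

Codes•-functional : Codes• p σ t v → Codes• p σ u w → _≡_ {A = Σ Tree Vertex} (t , v) (u , w)
Codes•-functional single single = refl
Codes•-functional single (atRoot _ () _)
Codes•-functional single (graft _ _ _ () _)
Codes•-functional (flat c) (flat d) with refl ← Codes•-functional c d = refl
Codes•-functional (flat _) (atRoot _ () _)
Codes•-functional (flat _) (graft _ _ _ () _)
Codes•-functional (atRoot _ () _) single
Codes•-functional (atRoot _ () _) (flat _)
Codes•-functional (atRoot {q} {σ} c e₁ e₂) (atRoot {q′} {σ′} c′ e₁′ e₂′)
  with refl ← inv-injective q q′ (∷-injectiveʳ (trans (sym e₁) e₁′))
  with refl ← reverse-injective {x = σ} {σ′} (trans (sym e₂) e₂′)
  with refl ← Codes-functional c c′ = refl
Codes•-functional (atRoot c e _) (graft c′ d j e′ _) =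
  contradiction (∷-injectiveʳ (trans (sym e) e′))
    (no-junction (Walk-inv (Codes-Walk c′)) (Walk-inv (Codes-Walk c)) (proj₂ (Codes•-Walk d)) j)
Codes•-functional (graft _ _ _ () _) single
Codes•-functional (graft _ _ _ () _) (flat _)
Codes•-functional (graft c d j e _) (atRoot c′ e′ _) =
  contradiction (∷-injectiveʳ (trans (sym e′) e))
    (no-junction (Walk-inv (Codes-Walk c)) (Walk-inv (Codes-Walk c′)) (proj₂ (Codes•-Walk d)) j)
Codes•-functional (graft {q} {x} {σ} c d j e₁ e₂) (graft {q′} {x′} {σ′} c′ d′ j′ e₁′ e₂′)
  with inv≡ , refl ← junction-cut-unique (Walk-inv (Codes-Walk c)) (Walk-inv (Codes-Walk c′))
                       (proj₂ (Codes•-Walk d)) (proj₂ (Codes•-Walk d′)) j j′ (∷-injectiveʳ (trans (sym e₁) e₁′))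
  with refl ← inv-injective q q′ inv≡
  with refl , refl ← reverse-++-injective (x ∷ σ) (x′ ∷ σ′)
                         (trans (Codes-length c) (sym (Codes-length c′))) (trans (sym e₂) e₂′)
  with refl ← Codes-functional c c′
  with refl ← Codes•-functional d d′ = refl

-- Below the root, the mark takes over from the label order in telling the subtrees apart: a code
-- marks only the root or a vertex of the right subtree, and a `swap` would send the latter to the
-- left. The junction step is then recovered from the labels around it.
Codes•-injective : Codes• p σ t v → Codes• q τ u w → (f : t ≅ u) → transport f v ≡ w → p ≡ q × σ ≡ τ
Codes•-injective single single leaf _ = refl , refl
Codes•-injective single (atRoot c _ _) f _ = contradiction f (¬Codes-leaf c)
Codes•-injective (flat c) (flat d) (node leaf g) refl with refl , refl ← Codes•-injective c d g refl = refl , refl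
Codes•-injective (flat _) (flat _) (swap _ _) ()
Codes•-injective (flat _) (atRoot _ _ _) (node _ _) ()
Codes•-injective (flat _) (atRoot _ _ _) (swap _ _) ()
Codes•-injective (flat _) (graft c _ _ _ _) (node f _) _ = contradiction f (¬Codes-leaf c)
Codes•-injective (flat _) (graft _ _ _ _ _) (swap _ _) ()
Codes•-injective (atRoot c _ _) single f _ = contradiction f (¬Codes-leaf′ c)
Codes•-injective (atRoot _ _ _) (flat _) (node _ _) ()
Codes•-injective (atRoot _ _ _) (flat _) (swap _ _) ()
Codes•-injective (atRoot c refl refl) (atRoot d refl refl) f _ with refl , refl ← Codes-injective c d f = refl , refl
Codes•-injective (atRoot _ _ _) (graft _ _ _ _ _) (node _ _) ()
Codes•-injective (atRoot _ _ _) (graft _ _ _ _ _) (swap _ _) ()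
Codes•-injective (graft c _ _ _ _) (flat _) (node f _) _ = contradiction f (¬Codes-leaf′ c)
Codes•-injective (graft _ _ _ _ _) (flat _) (swap _ _) ()
Codes•-injective (graft _ _ _ _ _) (atRoot _ _ _) (node _ _) ()
Codes•-injective (graft _ _ _ _ _) (atRoot _ _ _) (swap _ _) ()
Codes•-injective (graft c d j refl refl) (graft c′ d′ j′ refl refl) (node f g) refl
  with refl , refl ← Codes-injective c c′ f
  with refl , refl ← Codes•-injective d d′ g refl
  with refl ← Junction-unique j j′ = refl , refl
Codes•-injective (graft _ _ _ _ _) (graft _ _ _ _ _) (swap _ _) ()

Codes•-relabel : ∀ f → StrictlyMonoOn σ f → Codes• p σ t v → Codes• p (map f σ) (relabel f t) (relabelVertex f v)
Codes•-relabel f mono single   = single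
Codes•-relabel f mono (flat c) = flat (Codes•-relabel f (λ a b → mono (there a) (there b)) c)
Codes•-relabel f mono (atRoot {σ = σ} c e refl) =
  atRoot (Codes-relabel f (λ a b → mono (in′ a) (in′ b)) c) e (reverse-map f σ)
  where
  in′ : ∀ {z} → z ∈ σ → z ∈ reverse σ
  in′ = ∈-resp-↭ (↭-sym (↭-reverse σ))
Codes•-relabel f mono (graft {x = x} {σ = σ} {y = y} {τ = τ} c d j e refl) =
  graft (Codes-relabel f (λ a b → mono (inˡ a) (inˡ b)) c) (Codes•-relabel f (λ a b → mono (inʳ a) (inʳ b)) d)
    (Junction-relabel f mono (inˡ (here refl)) (inʳ (here refl)) j) e (map-reverse-++ f (x ∷ σ) (y ∷ τ))
  where
  inˡ : ∀ {z} → z ∈ x ∷ σ → z ∈ reverse (x ∷ σ) ++ y ∷ τ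
  inˡ = ∈-reverse-++ (x ∷ σ)
  inʳ : ∀ {z} → z ∈ y ∷ τ → z ∈ reverse (x ∷ σ) ++ y ∷ τ
  inʳ = ∈-++⁺ʳ (reverse (x ∷ σ))

record Coded• (t : Tree) (v : Vertex t) : Set where
  field
    {word}  : List Step
    {first} : ℕ
    {rest}  : List ℕ
    {shape} : Tree
    {spot}  : Vertex shape
    codes   : Codes• word (first ∷ rest) shape spot
    iso     : shape ≅ t
    sends   : transport iso spot ≡ v

  labels↭ : first ∷ rest ↭ leaves t
  labels↭ = ↭-trans (Codes•-leaves codes) (≅-leaves iso)

  first∈ : first ∈ leaves t
  first∈ = ∈-resp-↭ labels↭ (here refl)

module C• = Coded•

coded• : Codes• p σ u w → (f : u ≅ t) → transport f w ≡ v → Coded• t v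
coded• {u = u} c f e with _ , _ , refl ← ↭-leaves-∷ u (Codes•-leaves c) = record { codes = c ; iso = f ; sends = e }

Coded•-right : ∀ {l r} {v : Vertex r} → Unique (leaves (node l r)) → Coded• r v → Coded• (node l r) (right v)
Coded•-right {leaf x} _ D = coded• (flat (C•.codes D)) (node leaf (C•.iso D)) (cong right (C•.sends D))
Coded•-right {l@(node l₁ l₂)} u D with ul , _ , l#r ← Unique-++⁻ (leaves l) u
  with C ← Codes-surjective l₁ l₂ ul
  with _ , j ← Junction-exists (l#r (C.first∈ C) (C•.first∈ D)) =
  coded• (graft (C.codes C) (C•.codes D) j refl refl) (node (C.iso C) (C•.iso D)) (cong right (C•.sends D))

-- No code marks a vertex of a left subtree, so such marks are reached by exchanging the children of
-- the root.
Coded•-swap : ∀ {l r} {v : Vertex r} → Coded• (node l r) (right v) → Coded• (node r l) (left v)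
Coded•-swap {v = v} C = coded• (C•.codes C) (≅-trans (C•.iso C) flip)
  (trans (transport-trans (C•.iso C) flip (C•.spot C))
    (trans (cong (transport flip) (C•.sends C)) (cong left (transport-refl v))))
  where flip = swap ≅-refl ≅-refl

Codes•-surjective : ∀ t (v : Vertex t) → Unique (leaves t) → Coded• t v
Codes•-surjective (leaf x) root _ = coded• single leaf refl
Codes•-surjective (node l r) root u = coded• (atRoot (C.codes C) refl refl) (C.iso C) refl
  where C = Codes-surjective l r u
Codes•-surjective (node l r) (right v) u =
  Coded•-right u (Codes•-surjective r v (proj₁ (proj₂ (Unique-++⁻ (leaves l) u))))
Codes•-surjective (node l r) (left v) u =
  Coded•-swap (Coded•-right (Unique-↭ (++-comm (leaves l) (leaves r)) u)
    (Codes•-surjective l v (proj₁ (Unique-++⁻ (leaves l) u))))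

-- Undoing standardisation.

module _ {σ I : List ℕ} (uI : Unique I) (σ↭I : σ ↭ I) where

  -- On ranks of elements of `I`, `Λ I` undoes `Λ⁻¹ I`, so this is the contrapositive of the weak
  -- monotonicity of `Λ⁻¹ I`.
  Λ-mono : StrictlyMonoOn (map (Λ⁻¹ I) σ) (Λ I)
  Λ-mono a∈ b∈ a<b
    with x , x∈ , refl ← ∈-map⁻ (Λ⁻¹ I) a∈ | y , y∈ , refl ← ∈-map⁻ (Λ⁻¹ I) b∈ =
    subst₂ _<_ (sym (Λ-Λ⁻¹ uI (∈-resp-↭ σ↭I x∈))) (sym (Λ-Λ⁻¹ uI (∈-resp-↭ σ↭I y∈)))
      (≰⇒> λ y≤x → <⇒≱ a<b (Λ⁻¹-mono-≤ I y≤x))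

  map-Λ-Λ⁻¹ : map (Λ I) (map (Λ⁻¹ I) σ) ≡ σ
  map-Λ-Λ⁻¹ = trans (sym (map-∘ σ)) (map-id-local (All.tabulate λ x∈ → Λ-Λ⁻¹ uI (∈-resp-↭ σ↭I x∈)))

  Codes-Λ : ∀ t → Codes q (map (Λ⁻¹ I) σ) t → Codes q σ (relabel (Λ I) t)
  Codes-Λ t c = Codes-resp map-Λ-Λ⁻¹ (Codes-relabel (Λ I) Λ-mono c)

  Codes•-Λ : ∀ t v → Codes• q (map (Λ⁻¹ I) σ) t v → Codes• q σ (relabel (Λ I) t) (relabelVertex (Λ I) v)
  Codes•-Λ t v c = Codes•-resp map-Λ-Λ⁻¹ (Codes•-relabel (Λ I) Λ-mono c)

-- The recursions Φ and Φ′ produce codes.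

-- A prefix of `k` labels carries only `k ∸ 1` steps; step `k` belongs to neither piece and is
-- constrained by the labels on its two sides.
cut-junction : (P : WellLabelledPath n) → ∀ k → 1 ≤ k → k < n →
               ∃ λ s → steps P ≡ take (k ∸ 1) (steps P) ++ s ∷ drop k (steps P) ×
                       psum (steps P) k ≡ psum (steps P) (k ∸ 1) ℤ.+ value s ×
                       ∃₂ λ x σ → ∃₂ λ y τ → reverse (take k (labels P)) ≡ x ∷ σ ×
                                             drop k (labels P) ≡ y ∷ τ × Compatible s x y
cut-junction P (suc m) _ k<n with m<p ← s≤s⁻¹ (subst (suc m <_) (size P) k<n)
  with s , e , e′ ← take++at++drop (steps P) m m<p =
  s , e , e′ , WL-reverse-cut (take m (steps P))
    (subst₂ WellLabelled e (sym (take++drop≡id (suc m) (labels P))) (wellLabelled P))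
    (trans (length-I′ P (suc m) (<⇒≤ k<n))
      (cong suc (sym (trans (length-take m (steps P)) (m≤n⇒m⊓n≡m (<⇒≤ m<p))))))

-- The final `down` of a Motzkin path, omitted in its code, becomes under reversal the initial `up`
-- of the prefix.
inv-Motzkin : inv p ≡ q ++ down ∷ [] → p ≡ up ∷ inv q
inv-Motzkin {p} {q} e = trans (sym (inv-involutive p)) (trans (cong inv e) (inv-++ q (down ∷ [])))

-- In size 2, `Φ-acc` writes the leaves 1 and 2 outright, so the label word has to be identified as
-- 12.
cherry-labels : n ≡ 2 → x ∷ y ∷ [] ↭ [1‥ n ] → x < y → x ≡ 1 × y ≡ 2
cherry-labels refl e x<y with ∈-resp-↭ e (here refl) | ∈-resp-↭ e (there (here refl))
... | here refl         | here refl         = contradiction x<y (n≮n 1)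
... | here refl         | there (here refl) = refl , refl
... | there (here refl) | here refl         = contradiction x<y λ { (s≤s ()) }
... | there (here refl) | there (here refl) = contradiction x<y (n≮n 2)

down-step : ∀ s {i j} → j ≡ 0ℤ → i ≡ 1ℤ → j ≡ i ℤ.+ value s → s ≡ down
down-step down refl refl _ = refl
down-step flat refl refl ()
down-step up   refl refl ()

map-fixes : ∀ (f : A → A) as → map f as ≡ as → ∀ {a} → a ∈ as → f a ≡ a
map-fixes f (_ ∷ _)  e (here refl) = ∷-injectiveˡ e
map-fixes f (_ ∷ as) e (there a∈)  = map-fixes f as (∷-injectiveʳ e) a∈

-- Needed for `k` = `n`, where Φ′ marks the tree given by Φ without relabelling it. The list
-- `[1‥ n ]` is sorted, so its list of ranks is itself.
Λ⁻¹-[1‥] : ∀ {I} → I ↭ [1‥ n ] → x ∈ I → Λ⁻¹ I x ≡ x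
Λ⁻¹-[1‥] {n} {x} e x∈ = trans (Λ⁻¹-cong e x) (map-fixes (Λ⁻¹ [1‥ n ]) [1‥ n ]
  (trans (rank-sorted (AllPairsₚ.applyUpTo⁺₁ suc n λ i<j _ → s≤s i<j)) (cong [1‥_] (length-applyUpTo suc n)))
  (∈-resp-↭ e x∈))

Junction-≢flat : ∀ s → s ≢ flat → Compatible s x y → Junction s x y
Junction-≢flat down _  (f , _) = down (f refl)
Junction-≢flat flat ne _       = contradiction refl ne
Junction-≢flat up   _  (_ , g) = up (g refl)

module _ (P : WellLabelledPath n) (k : ℕ) where

  private
    I′ = take k (labels P)
    I″ = drop k (labels P)

  -- `PrefixCode` and `SuffixCode` are what `Φ-codes` yields for `reversedPrefix P k` and
  -- `suffix P k`, with standardised labels.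
  PrefixCode : List Step → Tree → Set
  PrefixCode q t = inv (take (k ∸ 1) (steps P)) ≡ q ++ down ∷ [] × Codes q (map (Λ⁻¹ I′) (reverse I′)) t

  SuffixCode : List Step → Tree → Set
  SuffixCode r u = drop k (steps P) ≡ r ++ down ∷ [] × Codes r (map (Λ⁻¹ I″) I″) u

  private
    prefix-Λ : ∀ t → Codes q (map (Λ⁻¹ I′) (reverse I′)) t → Codes q (reverse I′) (relabel (Λ I′) t)
    prefix-Λ = Codes-Λ (Uniqueₚ.take⁺ k (labels-unique P)) (↭-reverse I′)

    rejoin : reverse I′ ≡ σ → I″ ≡ τ → labels P ≡ reverse σ ++ τ
    rejoin e e′ = trans (sym (take++drop≡id k (labels P)))
      (cong₂ _++_ (trans (sym (reverse-involutive I′)) (cong reverse e)) e′)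

  module _ (1≤k : 1 ≤ k) (k<n : k < n) where

    Codes-graft : psum (steps P) k ≡ 0ℤ → psum (steps P) (k ∸ 1) ≡ 1ℤ →
                  (∃ λ q → PrefixCode q t) → (∃ λ r → SuffixCode r u) →
                  ∃ λ q → steps P ≡ q ++ down ∷ [] ×
                          Codes q (labels P) (node (relabel (Λ I′) t) (relabel (Λ I″) u))
    Codes-graft {t} {u} zero-at-k one-before-k (q , e , c) (r , e′ , d)
      with s , e″ , es , x , σ′ , y , τ , eσ , eτ , comp ← cut-junction P k 1≤k k<n
      -- The height falls from 1 to 0, so the junction is `down`; well-labelling then orders the two
      -- first labels as `graft` demands.
      with refl ← down-step s zero-at-k one-before-k es =
      up ∷ inv q ++ down ∷ r ,
      trans e″ (trans (cong₂ (λ a b → a ++ down ∷ b) (inv-Motzkin e) e′)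
        (cong (up ∷_) (sym (++-assoc (inv q) (down ∷ r) (down ∷ []))))) ,
      graft (Codes-resp eσ (prefix-Λ t c))
            (Codes-resp eτ (Codes-Λ (Uniqueₚ.drop⁺ k (labels-unique P)) ↭-refl u d))
            (proj₁ comp refl) refl (rejoin eσ eτ)

    -- Maximality of the cut enters as `psum (steps P) k ≢ 1ℤ`: a flat junction would keep the
    -- height at 1, and the other two steps are junctions.
    Codes•-graft : psum (steps P) (k ∸ 1) ≡ 1ℤ → psum (steps P) k ≢ 1ℤ →
                   (∃ λ q → PrefixCode q t) → Codes• (drop k (steps P)) (map (Λ⁻¹ I″) I″) u v →
                   Codes• (steps P) (labels P) (node (relabel (Λ I′) t) (relabel (Λ I″) u))
                     (right (relabelVertex (Λ I″) v))
    Codes•-graft {t} {u} {v} one-before-k not-one (q , e , c) d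
      with s , e″ , es , x , σ′ , y , τ , eσ , eτ , comp ← cut-junction P k 1≤k k<n =
      graft (Codes-resp eσ (prefix-Λ t c))
            (Codes•-resp eτ (Codes•-Λ (Uniqueₚ.drop⁺ k (labels-unique P)) ↭-refl u v d))
            (Junction-≢flat s not-flat comp)
            (trans e″ (cong (_++ s ∷ drop k (steps P)) (inv-Motzkin e))) (rejoin eσ eτ)
      where
      not-flat : s ≢ flat
      not-flat refl = not-one (trans es (trans (ℤₚ.+-identityʳ _) one-before-k))

  Codes•-atRoot : k ≡ n → (∃ λ q → PrefixCode q t) → Codes• (steps P) (labels P) t root
  Codes•-atRoot k≡n (q , e , c) = atRoot (Codes-resp reversed-labels c)
    (trans (sym take-steps) (inv-Motzkin e)) (sym (reverse-involutive (labels P)))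
    where
    take-steps : take (k ∸ 1) (steps P) ≡ steps P
    take-steps = take-all (k ∸ 1) (steps P) (≤-reflexive (cong (_∸ 1) (sym (trans k≡n (size P)))))
    take-labels : I′ ≡ labels P
    take-labels = take-all k (labels P) (≤-reflexive (trans (labels-length P) (sym k≡n)))
    reversed-labels : map (Λ⁻¹ I′) (reverse I′) ≡ reverse (labels P)
    reversed-labels = trans (cong (λ I → map (Λ⁻¹ I) (reverse I)) take-labels)
      (map-id-local (All.tabulate λ x∈ → Λ⁻¹-[1‥] (permutation P) (∈-resp-↭ (↭-reverse (labels P)) x∈)))

Codes-flat : ∀ {perm wl} → let P = path {n} (flat ∷ p) (x ∷ σ) perm wl in
             (∃ λ q → SuffixCode P 1 q t) →
             ∃ λ q → flat ∷ p ≡ q ++ down ∷ [] × Codes q (x ∷ σ) (node (leaf x) (relabel (Λ σ) t))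
Codes-flat {t = t} {perm = perm} {wl} (q , e , c) =
  flat ∷ q , cong (flat ∷_) e ,
  flat (Codes-Λ (Uniqueₚ.drop⁺ 1 (labels-unique (path _ _ perm wl))) ↭-refl t c)

Φ-codes : (a : Acc _<_ n) (P : WellLabelledPath n) (M : IsMotzkin n (steps P)) →
          ∃ λ q → steps P ≡ q ++ down ∷ [] × Codes q (labels P) (tree (Φ-acc a P M))
Φ-codes {n} _ (path [] _ _ _) (_ , total) = contradiction (trans (sym (psum-[] (n ∸ 1))) total) λ ()
Φ-codes _ P@(path (down ∷ []) (x ∷ y ∷ []) perm ((x<y , _) ∷ [-])) _
  with refl , refl ← cherry-labels (size P) perm (x<y refl) = [] , refl , cherry (x<y refl)
Φ-codes _ P@(path (down ∷ _ ∷ p) _ _ _) (nonneg , _) =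
  contradiction (nonneg 1 ≤-refl (subst (1 ≤_) (sym (cong (_∸ 2) (size P))) (s≤s z≤n))) λ ()
Φ-codes (acc rs) P@(path (flat ∷ p) (x ∷ σ) perm wl) M = Codes-flat {perm = perm} {wl}
  (Φ-codes (rs (∸-shrinks ≤-refl 1<n)) (suffix P 1 1<n) (suffix-Motzkin (flat ∷ p) 1 1<n refl M))
  where
  1<n = 1<size (size P)
Φ-codes (acc rs) P@(path (up ∷ p) σ _ _) M = Codes-graft P k 1≤k k<n zero-at-k one-before-k
  (Φ-codes (rs k<n) (reversedPrefix P k 1≤k (<⇒≤ k<n)) prefix-Motzkin)
  (Φ-codes (rs (∸-shrinks 1≤k k<n)) (suffix P k k<n) rest-Motzkin)
  where
  R = firstReturn (size P) M
  open Least R using (k)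
  open FirstReturnFacts (size P) M R

Φ′-codes : (a : Acc _<_ n) (P : WellLabelledPath n) (M : IsPositive n (steps P)) →
           Codes• (steps P) (labels P) (tree (underlying (Φ′-acc a P M))) (mark (Φ′-acc a P M))
Φ′-up-codes : (rs : ∀ {m} → m < n → Acc _<_ m) (perm : σ ↭ [1‥ n ]) (wl : WellLabelled (up ∷ p) σ)
              (M : IsPositive n (up ∷ p)) (R : GreatestUpTo n (CutAt (up ∷ p))) (d : Dec (GreatestUpTo.k R < n)) →
              Codes• (up ∷ p) σ (tree (underlying (Φ′-up rs perm wl M R d))) (mark (Φ′-up rs perm wl M R d))

Φ′-codes _ P@(path [] (x ∷ []) perm [-]) _
  with refl ← ↭-singleton-inv (↭-trans perm (↭-reflexive (cong [1‥_] (size P)))) = single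
Φ′-codes _ P@(path (down ∷ _) _ _ _) nonneg =
  contradiction (nonneg 1 ≤-refl (subst (1 ≤_) (sym (cong (_∸ 1) (size P))) (s≤s z≤n))) λ ()
Φ′-codes {n} (acc rs) P@(path (flat ∷ p) (x ∷ σ) perm _) M =
  flat (Codes•-Λ (Uniqueₚ.drop⁺ 1 (labels-unique P)) ↭-refl _ _
    (Φ′-codes (rs (∸-shrinks ≤-refl (1<size (size P)))) (suffix P 1 (1<size (size P)))
      (suffix-Positive {n} (flat ∷ p) 1 λ j _ → M (suc j) (s≤s z≤n))))
Φ′-codes {n} (acc rs) P@(path (up ∷ _) _ perm wl) M = Φ′-up-codes rs perm wl M R (GreatestUpTo.k R <? n)
  where
  R = lastAtOne (size P) M

Φ′-up-codes {n} {σ} {p} _ perm wl M R (no k≮n) = Codes•-atRoot P k (≤-antisym k≤n (≮⇒≥ k≮n))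
  (Φ-codes (<-wellFounded k) (reversedPrefix P k 1≤k k≤n) prefix-Motzkin)
  where
  P = path (up ∷ p) σ perm wl
  open GreatestUpTo R using (k; k≤n)
  open LastAtOneFacts (size P) M R
Φ′-up-codes {n} {σ} {p} rs perm wl M R (yes k<n) = Codes•-graft P k 1≤k k<n (proj₂ holds) not-one
  (Φ-codes (<-wellFounded k) (reversedPrefix P k 1≤k k≤n) prefix-Motzkin)
  (Φ′-codes (rs (∸-shrinks 1≤k k<n)) (suffix P k k<n) (rest-Positive k<n))
  where
  P = path (up ∷ p) σ perm wl
  open GreatestUpTo R using (k; k≤n; holds; maximal)
  open LastAtOneFacts (size P) M R
  -- Height 1 after `k` steps would make `suc k` an admissible cut, against the maximality of `k`.
  not-one : psum (up ∷ p) k ≢ 1ℤ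
  not-one e = contradiction (maximal k<n
    ((λ { {suc j} (s≤s j<k) (s≤s 1≤j) → positive-before-k j 1≤j j<k }) , e)) (n≮n k)

-- Bijectivity up to equality of words and isomorphism of marked trees.

≈-isEquivalence : IsEquivalence (_≈_ {n})
≈-isEquivalence = record
  { refl  = refl , refl
  ; sym   = λ (e , f) → sym e , sym f
  ; trans = λ (e , f) (e′ , f′) → trans e e′ , trans f f′
  }

≅•-refl : (T : MarkedTree n) → T ≅• T
≅•-refl T = ≅-refl , transport-refl (mark T)

≅•-sym : (T U : MarkedTree n) → T ≅• U → U ≅• T
≅•-sym T U (f , e) = ≅-sym f , trans (cong (transport (≅-sym f)) (sym e)) (transport-sym f (mark T))

≅•-trans : (T U V : MarkedTree n) → T ≅• U → U ≅• V → T ≅• V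
≅•-trans T U V (f , e) (g , e′) = ≅-trans f g ,
  trans (transport-trans f g (mark T)) (trans (cong (transport g) e) e′)

≅•-isEquivalence : IsEquivalence (_≅•_ {n})
≅•-isEquivalence = record
  { refl  = λ {T} → ≅•-refl T
  ; sym   = λ {T} {U} → ≅•-sym T U
  ; trans = λ {T} {U} {V} → ≅•-trans T U V
  }

Φ′-Codes• : (X : PositivePath n) →
            Codes• (steps (proj₁ X)) (labels (proj₁ X)) (tree (underlying (Φ′ X))) (mark (Φ′ X))
Φ′-Codes• {n} (P , M) = Φ′-codes (<-wellFounded n) P M

Codes•-≅ : Codes• p σ t v → Codes• p σ u w → Σ (t ≅ u) λ f → transport f v ≡ w
Codes•-≅ {v = v} c d with refl ← Codes•-functional c d = ≅-refl , transport-refl v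

-- Equal words may carry different proofs, which are also arguments of `Φ′`; functionality of codes
-- shows that the marked tree depends on the words alone.
Φ′-cong : (X Y : PositivePath n) → X ≈ Y → Φ′ X ≅• Φ′ Y
Φ′-cong X Y (refl , refl) = Codes•-≅ (Φ′-Codes• X) (Φ′-Codes• Y)

Φ′-injective : (X Y : PositivePath n) → Φ′ X ≅• Φ′ Y → X ≈ Y
Φ′-injective X Y (f , e) = Codes•-injective (Φ′-Codes• X) (Φ′-Codes• Y) f e

-- The code of `t` is itself a positive path. Its image under `Φ′` has a code with the same words,
-- so functionality identifies that image with `shape`, which is isomorphic to `t`.
Φ′-surjective : (T : MarkedTree n) → ∃ λ X → Φ′ X ≅• T
Φ′-surjective {n} T@(marked (labelled t t↭) v) = X , iso-T (Codes•-≅ (Φ′-Codes• X) codes)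
  where
  open Coded• (Codes•-surjective t v (Unique-↭ (↭-sym t↭) ([1‥]-unique n)))
  X : PositivePath n
  X = path word (first ∷ rest) (↭-trans labels↭ t↭) (Codes•-WL codes) ,
      λ j _ _ → subst (0ℤ ℤ.≤_) (ℤₚ.+-identityˡ _) (Walk-psum (proj₂ (Codes•-Walk codes)) j)
  iso-T : (Σ (tree (underlying (Φ′ X)) ≅ shape) λ f → transport f (mark (Φ′ X)) ≡ spot) → Φ′ X ≅• T
  iso-T (f , e) = ≅-trans f iso , trans (transport-trans f iso _) (trans (cong (transport iso) e) sends)

theorem2 : (n : ℕ) .{{_ : NonZero n}} → IsBijection (_≈_ {n}) (_≅•_ {n}) (Φ′ {n})
theorem2 n = record
  { isInjection = record
    { isCongruent = record
      { cong           = λ {X} {Y} → Φ′-cong X Y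
      ; isEquivalence₁ = ≈-isEquivalence
      ; isEquivalence₂ = ≅•-isEquivalence
      }
    ; injective = λ {X} {Y} → Φ′-injective X Y
    }
  ; surjective = λ T → let X , f = Φ′-surjective T in
      X , λ {Z} Z≈X → ≅•-trans (Φ′ Z) (Φ′ X) T (Φ′-cong Z X Z≈X) f
  }
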